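{- Let $\lambda$ and $\nu$ be $n$-cores. Then $(\lambda,\nu)$ is a horizontal strong strip if and only if $w_\nu w_\lambda^{ -1}$ is a cyclically decreasing element of $\tilde S_n$ with $\ell(w_\nu)=\ell(w_\lambda)+\ell(w_\nu w_\lambda^{ -1})$.
   Context: Fix $n\ge2$. $\tilde S_n$ is the affine symmetric group with generators $s_0,\dots,s_{n-1}$ (indices mod $n$), relations $s_i^2=1$, $s_is_{i+1}s_i=s_{i+1}s_is_{i+1}$, $s_is_j=s_js_i$ for $i-j\not\equiv\pm1\pmod n$; $\ell$ is the length. $\tilde S_n^0$ is the set of minimal length coset representatives of $\tilde S_n/\langle s_1,\dots,s_{n-1}\rangle$. A word in $\mathbb Z/n\mathbb Z$ is cyclically decreasing if each letter occurs at most once and $i+1$ precedes $i$ whenever both occur; an element is cyclically decreasing if it has a cyclically decreasing reduced word. Partitions are drawn in French convention ($\lambda_1$ is the bottom row); the cell in row $i$, column $j$ has $n$-residue $j-i\bmod n$. An $n$-core is a partition with no cell of hook length $n$. For an $n$-core with an addable corner of residue $i$, $s_i$ acts by adding all addable corners of residue $i$; this yields a bijection $\mathfrak a:\tilde S_n^0\to\{n\text{ -cores}\}$, $\mathfrak a(w)=s_{i_1}\cdots s_{i_\ell}\emptyset$ for any reduced word; write $w_\mu=\mathfrak a^{ -1}(\mu)$ and $\deg(\mu)=\ell(w_\mu)$. For $n$-cores, $\mu\lessdot_B\gamma$ means $\mu\subset\gamma$ and $\deg\gamma=\deg\mu+1$. For an $n$-core $\lambda$, $R(n-1,\lambda)=(\lambda_1+n-1,\lambda_1,\lambda_2,\dots)$.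 The pair $(\lambda,\nu)$ is a horizontal strong strip (of length $m=n-1+\deg(\lambda)-\deg(\nu)$) if $\lambda\subset\nu$ and there is a saturated chain $\nu=\nu^{(0)}\lessdot_B\nu^{(1)}\lessdot_B\cdots\lessdot_B\nu^{(m)}=R(n-1,\lambda)$ such that the bottom row of $\nu^{(i)}$ is strictly longer than the bottom row of $\nu^{(i-1)}$ for $1\le i\le m$.
   Formalization: For n = 2 the braid relation between s_0 and s_1 is not imposed: with it the group would be the finite S_3, which cannot be in bijection with the infinitely many 2-cores; the affine symmetric group is then taken as the infinite dihedral group. -}

module Defs where

open import Data.Nat using (ℕ; zero; suc; _+_; _*_; _∸_; _≤_; _<_; NonZero)
open import Data.Nat.DivMod using (_mod_)
open import Data.Nat.Properties using (_<?_)
open import Data.Fin using (Fin; toℕ)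
import Data.Fin as F
open import Data.Bool using (Bool; true; false; _∧_; _∨_; if_then_else_)
open import Data.Maybe using (Maybe; just; nothing)
open import Data.List using (List; []; _∷_; _++_; foldr; length; filter; reverse)
open import Data.List.Relation.Unary.All using (All)
open import Data.List.Relation.Unary.Linked using (Linked)
open import Data.List.Relation.Unary.Unique.Propositional using (Unique)
open import Data.List.Membership.Propositional using (_∈_)
open import Data.Product using (Σ; ∃; _×_)
open import Data.Sum using (_⊎_)
open import Relation.Nullary using (¬_)
open import Relation.Nullary.Decidable using (⌊_⌋)
open import Relation.Binary.PropositionalEquality using (_≡_; _≢_)

-- The affine symmetric group, by its Coxeter presentation.
-- Elements are represented by words in the generators s_0 .. s_{n-1}
-- (letters in Fin n = Z/nZ); equality of elements is the congruence
-- _~_ generated by the defining relations.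

Word : ℕ → Set
Word n = List (Fin n)

next : (n : ℕ) .{{_ : NonZero n}} → Fin n → Fin n
next n i = (toℕ i + 1) mod n

Adjacent : (n : ℕ) .{{_ : NonZero n}} → Fin n → Fin n → Set
Adjacent n i j = (j ≡ next n i) ⊎ (i ≡ next n j)

-- For n = 2 the affine symmetric group is the infinite dihedral group:
-- there is no braid relation between s_0 and s_1.
data Rel (n : ℕ) .{{_ : NonZero n}} : Word n → Word n → Set where
  square  : (i : Fin n) → Rel n (i ∷ i ∷ []) []
  braid   : 3 ≤ n → (i : Fin n) →
            Rel n (i ∷ next n i ∷ i ∷ []) (next n i ∷ i ∷ next n i ∷ [])
  commute : (i j : Fin n) → ¬ Adjacent n i j →
            Rel n (i ∷ j ∷ []) (j ∷ i ∷ [])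

infix 4 _~[_]_
data _~[_]_ : {n : ℕ} → Word n → (m : ℕ) → Word m → Set where
  ~rel   : ∀ {n} .{{_ : NonZero n}} (a b : Word n) {u v : Word n} → Rel n u v →
           (a ++ u ++ b) ~[ n ] (a ++ v ++ b)
  ~refl  : ∀ {n} {u : Word n} → u ~[ n ] u
  ~sym   : ∀ {n} {u v : Word n} → u ~[ n ] v → v ~[ n ] u
  ~trans : ∀ {n} {u v w : Word n} → u ~[ n ] v → v ~[ n ] w → u ~[ n ] w

Len : (n : ℕ) → Word n → ℕ → Set
Len n w k = (Σ (Word n) λ u → (u ~[ n ] w) × (length u ≡ k))
          × (∀ (u : Word n) → u ~[ n ] w → k ≤ length u)

Reduced : (n : ℕ) → Word n → Set
Reduced n w = ∀ (u : Word n) → u ~[ n ] w → length w ≤ length u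

-- w ∈ S̃_n^0 : w has minimal length in its coset w⟨s_1,…,s_{n-1}⟩,
-- i.e. ℓ(w) ≤ ℓ(w u) for every u in the parabolic subgroup.
Grassmannian : (n : ℕ) → Word n → Set
Grassmannian n w =
  ∀ (u : Word n) → All (λ i → toℕ i ≢ 0) u →
  ∀ (v : Word n) → v ~[ n ] (w ++ u) →
  Σ (Word n) λ x → (x ~[ n ] w) × (length x ≤ length v)

Precedes : {n : ℕ} → Fin n → Fin n → Word n → Set
Precedes {n} x y u = Σ (Word n) λ a → Σ (Word n) λ b → Σ (Word n) λ c →
  u ≡ a ++ (x ∷ b) ++ (y ∷ c)

CycDecWord : (n : ℕ) .{{_ : NonZero n}} → Word n → Set
CycDecWord n u = Unique u ×
  (∀ (i : Fin n) → i ∈ u → next n i ∈ u → Precedes (next n i) i u)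

CycDecElt : (n : ℕ) .{{_ : NonZero n}} → Word n → Set
CycDecElt n w = Σ (Word n) λ u → (u ~[ n ] w) × Reduced n u × CycDecWord n u

-- Partitions: lists of row lengths λ_1 ≥ λ_2 ≥ … > 0, the head being the
-- bottom row (French convention). Rows r and columns c are 0-indexed here,
-- so the cell (r, c) is the cell in row r+1, column c+1 of the paper and
-- its residue is c - r mod n = c + (n-1) r mod n.

Partition : Set
Partition = List ℕ

IsPartition : Partition → Set
IsPartition λ' = Linked (λ a b → b ≤ a) λ' × All (λ a → 0 < a) λ'

row : Partition → ℕ → ℕ
row []       _       = 0
row (x ∷ _)  zero    = x
row (_ ∷ xs) (suc r) = row xs r

col : Partition → ℕ → ℕ
col λ' c = length (filter (λ x → c <? x) λ')

residue : (n : ℕ) .{{_ : NonZero n}} → ℕ → ℕ → Fin n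
residue n r c = (c + (n ∸ 1) * r) mod n

hook : Partition → ℕ → ℕ → ℕ
hook λ' r c = (row λ' r ∸ c) + (col λ' c ∸ r) ∸ 1

IsCore : (n : ℕ) → Partition → Set
IsCore n λ' = IsPartition λ' ×
  (∀ r c → c < row λ' r → hook λ' r c ≢ n)

-- s_i acting on a core: add all addable corners of residue i.
-- prev = length of the previous (lower) row, nothing for the bottom row.
addResGo : (n : ℕ) .{{_ : NonZero n}} → Fin n → ℕ → Maybe ℕ → Partition → Partition
addResGo n i r prev [] with addable prev | ⌊ residue n r 0 F.≟ i ⌋
  where addable : Maybe ℕ → Bool
        addable nothing  = true
        addable (just p) = ⌊ 0 <? p ⌋
... | true | true = 1 ∷ []
... | _    | _    = []
addResGo n i r prev (x ∷ xs) =
  (if addable prev ∧ ⌊ residue n r x F.≟ i ⌋ then suc x else x)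
  ∷ addResGo n i (suc r) (just x) xs
  where addable : Maybe ℕ → Bool
        addable nothing  = true
        addable (just p) = ⌊ x <? p ⌋

addRes : (n : ℕ) .{{_ : NonZero n}} → Fin n → Partition → Partition
addRes n i λ' = addResGo n i 0 nothing λ'

act : (n : ℕ) .{{_ : NonZero n}} → Word n → Partition
act n w = foldr (addRes n) [] w

IsWordOf : (n : ℕ) .{{_ : NonZero n}} → Word n → Partition → Set
IsWordOf n w μ = Grassmannian n w × Reduced n w × (act n w ≡ μ)

Deg : (n : ℕ) .{{_ : NonZero n}} → Partition → ℕ → Set
Deg n μ d = Σ (Word n) λ w → IsWordOf n w μ × (length w ≡ d)

_⊆ₚ_ : Partition → Partition → Set
μ ⊆ₚ γ = ∀ r → row μ r ≤ row γ r

Cover : (n : ℕ) .{{_ : NonZero n}} → Partition → Partition → Set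
Cover n μ γ = IsCore n μ × IsCore n γ × μ ⊆ₚ γ ×
  (Σ ℕ λ d → Deg n μ d × Deg n γ (suc d))

data StripChain (n : ℕ) .{{_ : NonZero n}} : Partition → Partition → ℕ → Set where
  done : ∀ {μ} → StripChain n μ μ 0
  step : ∀ {μ γ τ m} → Cover n μ γ → row μ 0 < row γ 0 →
         StripChain n γ τ m → StripChain n μ τ (suc m)

R : ℕ → Partition → Partition
R k λ' = (row λ' 0 + k) ∷ λ'

HorizontalStrongStrip : (n : ℕ) .{{_ : NonZero n}} → Partition → Partition → Set
HorizontalStrongStrip n λ' ν = λ' ⊆ₚ ν ×
  Σ ℕ λ m → Σ ℕ λ dλ → Σ ℕ λ dν → Deg n λ' dλ × Deg n ν dν ×
    (m + dν ≡ (n ∸ 1) + dλ) × StripChain n ν (R (n ∸ 1) λ') m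

{-# OPTIONS --safe #-}
-- Cores are encoded by their sets of beads, on which the generator s_i acts by the permutation of ℤ
-- exchanging k and k + 1 for all k ≡ i (mod n). A word in which every letter adds cells is shown to be
-- determined by its core up to the Coxeter relations (a local analysis of two descents), so these are
-- exactly the reduced words of Grassmannian elements. The operator addRes is monotone for containment
-- (it is the 0-Hecke action), and containment of cores is compatible with degrees and satisfies the
-- lifting and deletion properties of the Bruhat order. Write ℓ for the length of the bottom row of λ.
-- The core R (n - 1) λ is obtained from λ by applying the letters ℓ, ℓ + 1, …, ℓ + n - 2 in turn.
-- Going down a strip chain from R (n - 1) λ, each cover deletes a letter; looking at the bottom row, it is
-- a letter of the cyclically decreasing word, never one of w_λ. Conversely a cyclically decreasing
-- word u with u w_λ reduced avoids the letter ℓ - 1, hence can be sorted, and inserting its missing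
-- letters one by one, smallest first, lengthens the bottom row and gives covers up to R (n - 1) λ.
module Submission where

open import Defs
open import Data.Nat using (ℕ; zero; suc; _+_; _*_; _∸_; _≤_; _<_; NonZero; z≤n; s≤s)
open import Data.Nat.Properties
open import Data.Nat.DivMod
open import Data.Nat.Divisibility using (_∣_; divides; ∣m+n∣m⇒∣n; ∣⇒≤)
open import Data.Nat.Solver using (module +-*-Solver)
open import Data.Integer as ℤ using (ℤ; +_; -[1+_]; _⊖_)
import Data.Integer.Properties as ℤ
open import Data.Fin using (Fin; toℕ)
import Data.Fin as F
open import Data.Fin.Properties using (toℕ-injective; toℕ-fromℕ<; toℕ<n)
open import Data.Maybe using (Maybe; just; nothing)
open import Data.List using (List; []; _∷_; _++_; length; reverse)
open import Data.List.Properties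
  using (++-assoc; ++-identityʳ; length-++; unfold-reverse; ∷-injectiveˡ; ∷-injectiveʳ; filter-accept; filter-reject)
open import Data.List.Relation.Unary.All as All using (All; []; _∷_)
import Data.List.Relation.Unary.All.Properties as All
open import Data.List.Relation.Unary.AllPairs using (AllPairs; []; _∷_)
open import Data.List.Relation.Unary.Any as Any using (here; there)
open import Data.List.Relation.Unary.Linked using (Linked; []; [-]; _∷_)
open import Data.List.Membership.Propositional using (_∈_)
open import Data.List.Membership.Propositional.Properties using (∈-∃++; ∈-++⁺ʳ)
open import Data.Product using (Σ; ∃; _×_; _,_; proj₁; proj₂)
open import Data.Sum using (_⊎_; inj₁; inj₂)
open import Data.Unit using (⊤; tt)
open import Function.Base using (_∘_)
open import Function.Bundles using (_⇔_; mk⇔)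
open import Relation.Nullary using (¬_; Dec; yes; no; contradiction)
open import Relation.Nullary.Decidable using (_×-dec_; _⊎-dec_)
open import Relation.Binary.PropositionalEquality

-- Integers as differences c ⊖ r

-- Equivalences of words are always exhibited by explicit rewriting, whereas lower bounds on lengths
-- come from the action `perm` on ℤ, which respects the relations. The bead set obtained from a word
-- depends only on its coset, so one bound serves both for being reduced and for being a shortest
-- coset representative. On an abacus, a closed set fills each residue class (a runner) from below,
-- and ascents and descents compare neighbouring runners. The local analysis looks at three
-- consecutive runners, which must be distinct: for n = 2 there is no braid relation, but there the
-- critical configurations contradict closedness. Letters are inserted smallest first because the
-- part to the right of the insertion is then a full run on top of λ, whose bottom row has the known
-- length ℓ + k. The larger letters to its left cannot lengthen a bottom row of that length, so each
-- insertion is visible in the bottom row.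

suc-⊖ : ∀ c r → ℤ.suc (c ⊖ r) ≡ suc c ⊖ r
suc-⊖ = ℤ.distribʳ-⊖-+-pos 1

⊖-cancel : ∀ a b c d → a ⊖ b ≡ c ⊖ d → a + d ≡ c + b
⊖-cancel a b c d e = ℤ.+-injective (begin
  + (a + d)                  ≡⟨ lemma a b d ⟨
  (a ⊖ b) ℤ.+ + (b + d)      ≡⟨ cong₂ ℤ._+_ e (cong +_ (+-comm b d)) ⟩
  (c ⊖ d) ℤ.+ + (d + b)      ≡⟨ lemma c d b ⟩
  + (c + b)                  ∎)
  where
  open ≡-Reasoning
  lemma : ∀ a b d → (a ⊖ b) ℤ.+ + (b + d) ≡ + (a + d)
  lemma a b d = begin
    (a ⊖ b) ℤ.+ + (b + d)  ≡⟨ ℤ.distribˡ-⊖-+-pos (b + d) a b ⟩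
    (a + (b + d)) ⊖ b      ≡⟨ cong₂ _⊖_ (trans (sym (+-assoc a b d))
                                (trans (cong (_+ d) (+-comm a b)) (+-assoc b a d))) (sym (+-identityʳ b)) ⟩
    (b + (a + d)) ⊖ (b + 0) ≡⟨ ℤ.+-cancelˡ-⊖ b (a + d) 0 ⟩
    (a + d) ⊖ 0            ∎

⊖-cong : ∀ a b c d → a + d ≡ c + b → a ⊖ b ≡ c ⊖ d
⊖-cong a b c d e = begin
  a ⊖ b              ≡⟨ ℤ.+-cancelˡ-⊖ d a b ⟨
  (d + a) ⊖ (d + b)  ≡⟨ cong₂ _⊖_ (trans (+-comm d a) (trans e (+-comm c b))) (+-comm d b) ⟩
  (b + c) ⊖ (b + d)  ≡⟨ ℤ.+-cancelˡ-⊖ b c d ⟩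
  c ⊖ d              ∎
  where open ≡-Reasoning

⊖-surjective : ∀ k → ∃ λ c → ∃ λ r → k ≡ c ⊖ r
⊖-surjective (+ c)     = c , 0 , refl
⊖-surjective -[1+ r ]  = 0 , suc r , refl

suc-injectiveℤ : ∀ {j k} → ℤ.suc j ≡ ℤ.suc k → j ≡ k
suc-injectiveℤ {j} {k} e =
  trans (sym (ℤ.pred-suc j)) (trans (cong ℤ.pred e) (ℤ.pred-suc k))

≤⇒+ : ∀ {j k} → j ℤ.≤ k → ∃ λ d → k ≡ j ℤ.+ + d
≤⇒+ {j} {k} j≤k = ℤ.∣ k ℤ.- j ∣ , (begin
  k                            ≡⟨ ℤ.+-identityʳ k ⟨
  k ℤ.+ ℤ.0ℤ                   ≡⟨ cong (ℤ._+_ k) (ℤ.+-inverseˡ j) ⟨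
  k ℤ.+ (ℤ.- j ℤ.+ j)          ≡⟨ ℤ.+-assoc k (ℤ.- j) j ⟨
  (k ℤ.- j) ℤ.+ j              ≡⟨ ℤ.+-comm _ j ⟩
  j ℤ.+ (k ℤ.- j)              ≡⟨ cong (ℤ._+_ j) (ℤ.0≤i⇒+∣i∣≡i (ℤ.i≤j⇒0≤j-i j≤k)) ⟨
  j ℤ.+ + ℤ.∣ k ℤ.- j ∣ ∎)
  where open ≡-Reasoning

-- Residues modulo n as functions of the content

%-cancel : ∀ a d n .{{_ : NonZero n}} → (a + d) % n ≡ a % n → n ∣ d
%-cancel a d n e = ∣m+n∣m⇒∣n {m = a / n * n} {n = d} (divides ((a + d) / n) eq) (divides (a / n) refl)
  where
  eq : a / n * n + d ≡ (a + d) / n * n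
  eq = +-cancelˡ-≡ (a % n) _ _ (begin
    a % n + (a / n * n + d)              ≡⟨ +-assoc (a % n) _ d ⟨
    a % n + a / n * n + d                ≡⟨ cong (_+ d) (m≡m%n+[m/n]*n a n) ⟨
    a + d                                ≡⟨ m≡m%n+[m/n]*n (a + d) n ⟩
    (a + d) % n + (a + d) / n * n        ≡⟨ cong (_+ (a + d) / n * n) e ⟩
    a % n + (a + d) / n * n              ∎)
    where open ≡-Reasoning

module _ (n : ℕ) .{{nz : NonZero n}} (2≤n : 2 ≤ n) where

  open ≡-Reasoning

  private
    1+[n∸1] : suc (n ∸ 1) ≡ n
    1+[n∸1] = m+[n∸m]≡n {1} (≤-trans (s≤s z≤n) 2≤n)

  toℕ-residue : ∀ r c → toℕ (residue n r c) ≡ (c + (n ∸ 1) * r) % n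
  toℕ-residue r c = toℕ-fromℕ< _

  residue-period : ∀ r c → residue n r (c + n) ≡ residue n r c
  residue-period r c = toℕ-injective (begin
    toℕ (residue n r (c + n))        ≡⟨ toℕ-residue r (c + n) ⟩
    (c + n + (n ∸ 1) * r) % n        ≡⟨ cong (_% n) (trans (+-assoc c n _)
                                          (trans (cong (_+_ c) (+-comm n _)) (sym (+-assoc c _ n)))) ⟩
    (c + (n ∸ 1) * r + n) % n        ≡⟨ [m+n]%n≡m%n _ n ⟩
    (c + (n ∸ 1) * r) % n            ≡⟨ toℕ-residue r c ⟨
    toℕ (residue n r c)              ∎)

  residue-diagonal : ∀ r c → residue n (suc r) (suc c) ≡ residue n r c
  residue-diagonal r c = toℕ-injective (begin
    toℕ (residue n (suc r) (suc c))      ≡⟨ toℕ-residue (suc r) (suc c) ⟩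
    (suc c + (n ∸ 1) * suc r) % n        ≡⟨ cong (_% n) eq ⟩
    (c + (n ∸ 1) * r + n) % n            ≡⟨ [m+n]%n≡m%n _ n ⟩
    (c + (n ∸ 1) * r) % n                ≡⟨ toℕ-residue r c ⟨
    toℕ (residue n r c)                  ∎)
    where
    open +-*-Solver
    eq : suc c + (n ∸ 1) * suc r ≡ c + (n ∸ 1) * r + n
    eq = trans (solve 3 (λ c p r → con 1 :+ c :+ p :* (con 1 :+ r) := c :+ p :* r :+ (con 1 :+ p))
                  refl c (n ∸ 1) r)
               (cong (_+_ (c + (n ∸ 1) * r)) 1+[n∸1])

  residue-suc : ∀ r c → residue n r (suc c) ≡ next n (residue n r c)
  residue-suc r c = toℕ-injective (begin
    toℕ (residue n r (suc c))            ≡⟨ toℕ-residue r (suc c) ⟩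
    suc (c + (n ∸ 1) * r) % n            ≡⟨ cong (_% n) (+-comm 1 _) ⟩
    (c + (n ∸ 1) * r + 1) % n            ≡⟨ %-distribˡ-+ _ 1 n ⟩
    ((c + (n ∸ 1) * r) % n + 1 % n) % n  ≡⟨ cong (λ x → (x + 1 % n) % n)
                                             (trans (sym (m%n%n≡m%n _ n)) (cong (_% n) (sym (toℕ-residue r c)))) ⟩
    (toℕ (residue n r c) % n + 1 % n) % n ≡⟨ %-distribˡ-+ _ 1 n ⟨
    (toℕ (residue n r c) + 1) % n        ≡⟨ toℕ-fromℕ< _ ⟨
    toℕ (next n (residue n r c))         ∎)

  opaque
    -- The residue of a cell depends only on its content, so nonnegative contents are read off the
    -- bottom row and negative ones off the first column.
    res : ℤ → Fin n
    res (+ c)     = residue n 0 c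
    res -[1+ r ]  = residue n (suc r) 0

    res-⊖ : ∀ c r → res (c ⊖ r) ≡ residue n r c
    res-⊖ c       zero    = refl
    res-⊖ zero    (suc r) = refl
    res-⊖ (suc c) (suc r) =
      trans (cong res (ℤ.[1+m]⊖[1+n]≡m⊖n c r)) (trans (res-⊖ c r) (sym (residue-diagonal r c)))

  res-suc : ∀ k → res (ℤ.suc k) ≡ next n (res k)
  res-suc k with c , r , refl ← ⊖-surjective k = begin
    res (ℤ.suc (c ⊖ r))     ≡⟨ cong res (suc-⊖ c r) ⟩
    res (suc c ⊖ r)         ≡⟨ res-⊖ (suc c) r ⟩
    residue n r (suc c)     ≡⟨ residue-suc r c ⟩
    next n (residue n r c)  ≡⟨ cong (next n) (res-⊖ c r) ⟨
    next n (res (c ⊖ r))    ∎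

  res-period : ∀ k → res (k ℤ.+ + n) ≡ res k
  res-period k with c , r , refl ← ⊖-surjective k = begin
    res ((c ⊖ r) ℤ.+ + n)   ≡⟨ cong res (ℤ.distribˡ-⊖-+-pos n c r) ⟩
    res ((c + n) ⊖ r)       ≡⟨ res-⊖ (c + n) r ⟩
    residue n r (c + n)     ≡⟨ residue-period r c ⟩
    residue n r c           ≡⟨ res-⊖ c r ⟨
    res (c ⊖ r)             ∎

  res-cancel : ∀ k d → res (k ℤ.+ + d) ≡ res k → n ∣ d
  res-cancel k d e with c , r , refl ← ⊖-surjective k =
    %-cancel (c + (n ∸ 1) * r) d n (begin
      (c + (n ∸ 1) * r + d) % n  ≡⟨ cong (_% n) (trans (+-assoc c _ d)
                                      (trans (cong (_+_ c) (+-comm _ d)) (sym (+-assoc c d _)))) ⟩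
      (c + d + (n ∸ 1) * r) % n  ≡⟨ toℕ-residue r (c + d) ⟨
      toℕ (residue n r (c + d))  ≡⟨ cong toℕ (res-⊖ (c + d) r) ⟨
      toℕ (res ((c + d) ⊖ r))    ≡⟨ cong (toℕ ∘ res) (ℤ.distribˡ-⊖-+-pos d c r) ⟨
      toℕ (res ((c ⊖ r) ℤ.+ + d)) ≡⟨ cong toℕ e ⟩
      toℕ (res (c ⊖ r))          ≡⟨ cong toℕ (res-⊖ c r) ⟩
      toℕ (residue n r c)        ≡⟨ toℕ-residue r c ⟩
      (c + (n ∸ 1) * r) % n      ∎)

  res-near : ∀ k d → 0 < d → d < n → res (k ℤ.+ + d) ≢ res k
  res-near k (suc d) _ d<n e = <⇒≱ d<n (∣⇒≤ (res-cancel k (suc d) e))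

  res-toℕ : ∀ i → res (+ toℕ i) ≡ i
  res-toℕ i = toℕ-injective (begin
    toℕ (res (+ toℕ i))           ≡⟨ cong toℕ (res-⊖ (toℕ i) 0) ⟩
    toℕ (residue n 0 (toℕ i))     ≡⟨ toℕ-residue 0 (toℕ i) ⟩
    (toℕ i + (n ∸ 1) * 0) % n     ≡⟨ cong (_% n) (trans (cong (_+_ (toℕ i)) (*-zeroʳ (n ∸ 1))) (+-identityʳ _)) ⟩
    toℕ i % n                     ≡⟨ m<n⇒m%n≡m (toℕ<n i) ⟩
    toℕ i                         ∎)

  next-injective : ∀ {i j} → next n i ≡ next n j → i ≡ j
  next-injective {i} {j} e = trans (sym (prev-next i)) (trans (cong prev e) (prev-next j))
    where
    prev : Fin n → Fin n
    -- Going up one row adds n - 1, that is -1 modulo n.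
    prev i = residue n 1 (toℕ i)
    prev-next : ∀ i → prev (next n i) ≡ i
    prev-next i = toℕ-injective (begin
      toℕ (prev (next n i))                    ≡⟨ toℕ-residue 1 _ ⟩
      (toℕ (next n i) + (n ∸ 1) * 1) % n       ≡⟨ cong₂ (λ x y → (x + y) % n) (toℕ-fromℕ< _) (*-identityʳ (n ∸ 1)) ⟩
      ((toℕ i + 1) % n + (n ∸ 1)) % n          ≡⟨ %-distribˡ-+ _ (n ∸ 1) n ⟩
      ((toℕ i + 1) % n % n + (n ∸ 1) % n) % n  ≡⟨ cong (λ x → (x + (n ∸ 1) % n) % n) (m%n%n≡m%n (toℕ i + 1) n) ⟩
      ((toℕ i + 1) % n + (n ∸ 1) % n) % n      ≡⟨ %-distribˡ-+ (toℕ i + 1) (n ∸ 1) n ⟨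
      (toℕ i + 1 + (n ∸ 1)) % n                ≡⟨ cong (_% n) (trans (+-assoc (toℕ i) 1 _) (cong (_+_ (toℕ i)) 1+[n∸1])) ⟩
      (toℕ i + n) % n                          ≡⟨ [m+n]%n≡m%n (toℕ i) n ⟩
      toℕ i % n                                ≡⟨ m<n⇒m%n≡m (toℕ<n i) ⟩
      toℕ i                                    ∎)

  private
    shift-next : ∀ i → res (+ toℕ i ℤ.+ + 1) ≡ next n i
    shift-next i = trans (cong res (ℤ.+-comm (+ toℕ i) (+ 1)))
      (trans (res-suc (+ toℕ i)) (cong (next n) (res-toℕ i)))

  next≢id : ∀ i → next n i ≢ i
  next≢id i e = res-near (+ toℕ i) 1 (s≤s z≤n) 2≤n
    (trans (shift-next i) (trans e (sym (res-toℕ i))))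

  next²≢id : 3 ≤ n → ∀ i → next n (next n i) ≢ i
  next²≢id 3≤n i e = res-near (+ toℕ i) 2 (s≤s z≤n) 3≤n
    (trans (cong res (trans (ℤ.+-comm (+ toℕ i) (+ 2)) (ℤ.+-assoc (+ 1) (+ 1) (+ toℕ i))))
    (trans (res-suc (ℤ.suc (+ toℕ i))) (trans (cong (next n) (trans (res-suc (+ toℕ i)) (cong (next n) (res-toℕ i))))
    (trans e (sym (res-toℕ i))))))

  next²≡id : ¬ (3 ≤ n) → ∀ i → next n (next n i) ≡ i
  next²≡id n<3 i = begin
    next n (next n i)                        ≡⟨ cong (λ x → next n (next n x)) (res-toℕ i) ⟨
    next n (next n (res (+ toℕ i)))          ≡⟨ cong (next n) (res-suc (+ toℕ i)) ⟨
    next n (res (ℤ.suc (+ toℕ i)))           ≡⟨ res-suc (ℤ.suc (+ toℕ i)) ⟨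
    res (+ (2 + toℕ i))                      ≡⟨ cong (res ∘ +_) (+-comm 2 (toℕ i)) ⟩
    res (+ (toℕ i + 2))                      ≡⟨ cong (λ m → res (+ (toℕ i + m))) (≤-antisym 2≤n (≤-pred (≰⇒> n<3))) ⟩
    res (+ toℕ i ℤ.+ + n)                    ≡⟨ res-period (+ toℕ i) ⟩
    res (+ toℕ i)                            ≡⟨ res-toℕ i ⟩
    i                                        ∎

  -- The affine permutations of ℤ

  opaque
    σ : Fin n → ℤ → ℤ
    σ i k with res k F.≟ i | res k F.≟ next n i
    ... | yes _ | _     = ℤ.suc k
    ... | no _  | yes _ = ℤ.pred k
    ... | no _  | no _  = k

    σ-lower : ∀ {i k} → res k ≡ i → σ i k ≡ ℤ.suc k
    σ-lower {i} {k} e with res k F.≟ i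
    ... | yes _ = refl
    ... | no ≢i = contradiction e ≢i

    σ-upper : ∀ {i k} → res k ≡ i → σ i (ℤ.suc k) ≡ k
    σ-upper {i} {k} e with res (ℤ.suc k) F.≟ i | res (ℤ.suc k) F.≟ next n i
    ... | yes e′ | _     = contradiction (trans (sym (res-suc k)) (trans e′ (sym e))) (next≢id (res k))
    ... | no _   | yes _ = ℤ.pred-suc k
    ... | no _   | no ≢  = contradiction (trans (res-suc k) (cong (next n) e)) ≢

    σ-other : ∀ {i k} → res k ≢ i → res k ≢ next n i → σ i k ≡ k
    σ-other {i} {k} ≢i ≢ni with res k F.≟ i | res k F.≟ next n i
    ... | yes e | _     = contradiction e ≢i
    ... | no _  | yes e = contradiction e ≢ni
    ... | no _  | no _  = refl

  res≡next⇒ : ∀ {i} k → res k ≡ next n i → ∃ λ j → k ≡ ℤ.suc j × res j ≡ i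
  res≡next⇒ k e = ℤ.pred k , sym (ℤ.suc-pred k) ,
    next-injective (trans (sym (res-suc (ℤ.pred k))) (trans (cong res (ℤ.suc-pred k)) e))

  data Position (i : Fin n) : ℤ → Set where
    lower : ∀ {k} → res k ≡ i → Position i k
    upper : ∀ {k} → res k ≡ i → Position i (ℤ.suc k)
    other : ∀ {k} → res k ≢ i → res k ≢ next n i → Position i k

  position : ∀ i k → Position i k
  position i k with res k F.≟ i | res k F.≟ next n i
  ... | yes e  | _     = lower e
  ... | no ≢i  | no ≢  = other ≢i ≢
  ... | no _   | yes e with _ , refl , e′ ← res≡next⇒ k e = upper e′

  σ-involutive : ∀ i k → σ i (σ i k) ≡ k
  σ-involutive i k with position i k
  ... | lower e   = trans (cong (σ i) (σ-lower e)) (σ-upper e)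
  ... | upper e   = trans (cong (σ i) (σ-upper e)) (σ-lower e)
  ... | other a b = trans (cong (σ i) (σ-other a b)) (σ-other a b)

  σ-period : ∀ i k → σ i (k ℤ.+ + n) ≡ σ i k ℤ.+ + n
  σ-period i k with position i k
  ... | lower e = trans (σ-lower (trans (res-period k) e))
      (trans (sym (ℤ.+-assoc (+ 1) k (+ n))) (cong (ℤ._+ + n) (sym (σ-lower e))))
  ... | upper {j} e = trans (cong (σ i) (ℤ.+-assoc (+ 1) j (+ n)))
      (trans (σ-upper (trans (res-period j) e)) (cong (ℤ._+ + n) (sym (σ-upper e))))
  ... | other a b = trans (σ-other (a ∘ trans (sym (res-period k))) (b ∘ trans (sym (res-period k))))
      (cong (ℤ._+ + n) (sym (σ-other a b)))

  Far : Fin n → Fin n → Set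
  Far i j = i ≢ j × ¬ Adjacent n i j

  Far-sym : ∀ {i j} → Far i j → Far j i
  Far-sym (i≢j , ¬adj) = i≢j ∘ sym , λ where
    (inj₁ e) → ¬adj (inj₂ e)
    (inj₂ e) → ¬adj (inj₁ e)

  σ-far-lower : ∀ {i j k} → Far i j → res k ≡ i → σ j k ≡ k
  σ-far-lower (i≢j , ¬adj) refl = σ-other i≢j (¬adj ∘ inj₂)

  σ-far-upper : ∀ {i j k} → Far i j → res k ≡ i → σ j (ℤ.suc k) ≡ ℤ.suc k
  σ-far-upper {k = k} (i≢j , ¬adj) refl = σ-other
    (λ e → ¬adj (inj₁ (trans (sym e) (res-suc k))))
    (λ e → i≢j (next-injective (trans (sym (res-suc k)) e)))

  σ-commute : ∀ {i j} → Far i j → ∀ k → σ i (σ j k) ≡ σ j (σ i k)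
  σ-commute {i} {j} far k with position i k | position j k
  ... | lower e | _ = trans (cong (σ i) (σ-far-lower far e)) (trans (σ-lower e)
          (sym (trans (cong (σ j) (σ-lower e)) (σ-far-upper far e))))
  ... | upper e | _ = trans (cong (σ i) (σ-far-upper far e)) (trans (σ-upper e)
          (sym (trans (cong (σ j) (σ-upper e)) (σ-far-lower far e))))
  ... | other a b | lower e = trans (cong (σ i) (σ-lower e)) (trans (σ-far-upper (Far-sym far) e)
          (sym (trans (cong (σ j) (σ-other a b)) (σ-lower e))))
  ... | other a b | upper e = trans (cong (σ i) (σ-upper e)) (trans (σ-far-lower (Far-sym far) e)
          (sym (trans (cong (σ j) (σ-other a b)) (σ-upper e))))
  ... | other a b | other c d = trans (cong (σ i) (σ-other c d))
          (trans (σ-other a b) (sym (trans (cong (σ j) (σ-other a b)) (σ-other c d))))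

  res-suc≡ : ∀ {i k} → res k ≡ i → res (ℤ.suc k) ≡ next n i
  res-suc≡ {k = k} refl = res-suc k

  module _ (3≤n : 3 ≤ n) {i : Fin n} {k : ℤ} (e : res k ≡ i) where

    σ-next-below : σ (next n i) k ≡ k
    σ-next-below = σ-other (λ e′ → next≢id i (trans (sym e′) e))
      (λ e′ → next²≢id 3≤n i (trans (sym e′) e))

    σ-above-next : σ i (ℤ.suc (ℤ.suc k)) ≡ ℤ.suc (ℤ.suc k)
    σ-above-next = σ-other (λ e′ → next²≢id 3≤n i (trans (sym (res-suc≡ (res-suc≡ e))) e′))
      (λ e′ → next≢id (next n i) (trans (sym (res-suc≡ (res-suc≡ e))) e′))

  σ-braid : 3 ≤ n → ∀ i k →
    σ i (σ (next n i) (σ i k)) ≡ σ (next n i) (σ i (σ (next n i) k))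
  σ-braid 3≤n i k = go (position i k) (position j k)
    where
    j = next n i
    path : ∀ a b c {k l m o} → σ a k ≡ l → σ b l ≡ m → σ c m ≡ o → σ c (σ b (σ a k)) ≡ o
    path a b c refl refl refl = refl
    go : ∀ {k} → Position i k → Position j k → σ i (σ j (σ i k)) ≡ σ j (σ i (σ j k))
    go (lower e) _ = trans
      (path i j i (σ-lower e) (σ-lower (res-suc≡ e)) (σ-above-next 3≤n e))
      (sym (path j i j (σ-next-below 3≤n e) (σ-lower e) (σ-lower (res-suc≡ e))))
    go (upper e) _ = trans
      (path i j i (σ-upper e) (σ-next-below 3≤n e) (σ-lower e))
      (sym (path j i j (σ-lower (res-suc≡ e)) (σ-above-next 3≤n e) (σ-upper (res-suc≡ e))))
    go (other a b) (lower e) = contradiction e b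
    go (other a b) (other c d) = trans
      (path i j i (σ-other a b) (σ-other c d) (σ-other a b))
      (sym (path j i j (σ-other c d) (σ-other a b) (σ-other c d)))
    go (other a b) (upper {k} e) with l , refl , e′ ← res≡next⇒ k e = trans
      (path i j i (σ-above-next 3≤n e′) (σ-upper e) (σ-upper e′))
      (sym (path j i j (σ-upper e) (σ-upper e′) (σ-next-below 3≤n e′)))

  -- The first letter acts first. Putting `i` in front of a word then precomposes with `σ i`, which
  -- is how `addRes` changes a bead set.
  perm : Word n → ℤ → ℤ
  perm []      k = k
  perm (i ∷ u) k = perm u (σ i k)

  perm-++ : ∀ u v k → perm (u ++ v) k ≡ perm v (perm u k)
  perm-++ []      v k = refl
  perm-++ (i ∷ u) v k = perm-++ u v (σ i k)

  perm-Rel : ∀ {u v} → Rel n u v → ∀ k → perm u k ≡ perm v k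
  perm-Rel (square i)        k = σ-involutive i k
  perm-Rel (braid 3≤n i)     k = σ-braid 3≤n i k
  perm-Rel (commute i j ¬adj) k with i F.≟ j
  ... | yes refl = refl
  ... | no i≢j   = sym (σ-commute (i≢j , ¬adj) k)

  perm-~ : ∀ {u v} → u ~[ n ] v → ∀ k → perm u k ≡ perm v k
  perm-~ (~rel a b {u} {v} r) k = begin
    perm (a ++ u ++ b) k         ≡⟨ perm-++ a (u ++ b) k ⟩
    perm (u ++ b) (perm a k)     ≡⟨ perm-++ u b _ ⟩
    perm b (perm u (perm a k))   ≡⟨ cong (perm b) (perm-Rel r (perm a k)) ⟩
    perm b (perm v (perm a k))   ≡⟨ perm-++ v b _ ⟨
    perm (v ++ b) (perm a k)     ≡⟨ perm-++ a (v ++ b) k ⟨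
    perm (a ++ v ++ b) k         ∎
  perm-~ ~refl        k = refl
  perm-~ (~sym p)     k = sym (perm-~ p k)
  perm-~ (~trans p q) k = trans (perm-~ p k) (perm-~ q k)

  perm-period : ∀ u k → perm u (k ℤ.+ + n) ≡ perm u k ℤ.+ + n
  perm-period []      k = refl
  perm-period (i ∷ u) k = trans (cong (perm u) (σ-period i k)) (perm-period u (σ i k))

  -- Congruence properties of ~

  ~-reflexive : ∀ {u v : Word n} → u ≡ v → u ~[ n ] v
  ~-reflexive refl = ~refl

  ~-++ˡ : ∀ (c : Word n) {u v} → u ~[ n ] v → (c ++ u) ~[ n ] (c ++ v)
  ~-++ˡ c (~rel a b {u} {v} r) =
    subst₂ (λ x y → x ~[ n ] y) (++-assoc c a (u ++ b)) (++-assoc c a (v ++ b)) (~rel (c ++ a) b r)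
  ~-++ˡ c ~refl        = ~refl
  ~-++ˡ c (~sym p)     = ~sym (~-++ˡ c p)
  ~-++ˡ c (~trans p q) = ~trans (~-++ˡ c p) (~-++ˡ c q)

  ~-++ʳ : ∀ (c : Word n) {u v} → u ~[ n ] v → (u ++ c) ~[ n ] (v ++ c)
  ~-++ʳ c (~rel a b {u} {v} r) = subst₂ (λ x y → x ~[ n ] y) (eq u) (eq v) (~rel a (b ++ c) r)
    where
    eq : ∀ u → a ++ u ++ b ++ c ≡ (a ++ u ++ b) ++ c
    eq u = trans (cong (a ++_) (sym (++-assoc u b c))) (sym (++-assoc a (u ++ b) c))
  ~-++ʳ c ~refl        = ~refl
  ~-++ʳ c (~sym p)     = ~sym (~-++ʳ c p)
  ~-++ʳ c (~trans p q) = ~trans (~-++ʳ c p) (~-++ʳ c q)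

  ~-square : ∀ i u → (i ∷ i ∷ u) ~[ n ] u
  ~-square i u = ~rel [] u (square i)

  ~-commute : ∀ {i j} → ¬ Adjacent n i j → ∀ u → (i ∷ j ∷ u) ~[ n ] (j ∷ i ∷ u)
  ~-commute ¬adj u = ~rel [] u (commute _ _ ¬adj)

  ~-braid : 3 ≤ n → ∀ {i j} → Adjacent n i j → ∀ u → (i ∷ j ∷ i ∷ u) ~[ n ] (j ∷ i ∷ j ∷ u)
  ~-braid 3≤n {i}     (inj₁ refl) u = ~rel [] u (braid 3≤n i)
  ~-braid 3≤n {j = j} (inj₂ refl) u = ~sym (~rel [] u (braid 3≤n j))

  ~-inverseˡ : ∀ w → (reverse w ++ w) ~[ n ] []
  ~-inverseˡ []      = ~refl
  ~-inverseˡ (i ∷ w) = ~trans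
    (~-reflexive (trans (cong (_++ (i ∷ w)) (unfold-reverse i w)) (++-assoc (reverse w) (i ∷ []) (i ∷ w))))
    (~trans (~-++ˡ (reverse w) (~-square i w)) (~-inverseˡ w))

  ~-inverseʳ : ∀ w → (w ++ reverse w) ~[ n ] []
  ~-inverseʳ []      = ~refl
  ~-inverseʳ (i ∷ w) = ~trans
    (~-reflexive (cong (i ∷_) (trans (cong (w ++_) (unfold-reverse i w)) (sym (++-assoc w (reverse w) (i ∷ []))))))
    (~trans (~-++ˡ (i ∷ []) (~-++ʳ (i ∷ []) (~-inverseʳ w))) (~-square i []))

  -- Subsets of ℤ closed under subtraction of n

  Subset : Set₁
  Subset = ℤ → Set

  infix 4 _≈_
  _≈_ : Subset → Subset → Set
  F ≈ G = ∀ k → (F k → G k) × (G k → F k)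

  ≈-sym : ∀ {F G} → F ≈ G → G ≈ F
  ≈-sym e k = proj₂ (e k) , proj₁ (e k)

  ≈-trans : ∀ {F G H} → F ≈ G → G ≈ H → F ≈ H
  ≈-trans e f k = proj₁ (f k) ∘ proj₁ (e k) , proj₂ (e k) ∘ proj₂ (f k)

  ≡⇒≈ : ∀ F {f g : ℤ → ℤ} → (∀ k → f k ≡ g k) → F ∘ f ≈ F ∘ g
  ≡⇒≈ F e k = subst F (e k) , subst F (sym (e k))

  -- For bead sets this is the abacus form of being an n-core: on each runner no bead lies above a
  -- gap.
  Closed : Subset → Set
  Closed F = ∀ k → F (k ℤ.+ + n) → F k

  closed-multiple : ∀ {F} → Closed F → ∀ q k → F (k ℤ.+ + (q * n)) → F k
  closed-multiple {F} cl zero    k Fk = subst F (ℤ.+-identityʳ k) Fk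
  closed-multiple {F} cl (suc q) k Fk = closed-multiple cl q k (cl _ (subst F eq Fk))
    where
    eq : k ℤ.+ + (n + q * n) ≡ k ℤ.+ + (q * n) ℤ.+ + n
    eq = trans (cong (λ x → k ℤ.+ + x) (+-comm n (q * n))) (sym (ℤ.+-assoc k (+ (q * n)) (+ n)))

  closed-≤ : ∀ {F j k} → Closed F → j ℤ.≤ k → res j ≡ res k → F k → F j
  closed-≤ {F} {j} cl j≤k e Fk with d , refl ← ≤⇒+ j≤k with res-cancel j d (sym e)
  ... | divides q refl = closed-multiple cl q j Fk

  closed-σ : ∀ {F} i → Closed F → Closed (F ∘ σ i)
  closed-σ {F} i cl k = cl (σ i k) ∘ subst F (σ-period i k)

  -- For a bead set, an ascent is an addable corner of residue `i` and a descent a removable one,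
  -- since adding a cell of content k moves a bead from k to k + 1.
  Asc Dsc Fix : Fin n → Subset → Set
  Asc i F = ∃ λ k → res k ≡ i × F k × ¬ F (ℤ.suc k)
  Dsc i F = ∃ λ k → res k ≡ i × ¬ F k × F (ℤ.suc k)
  Fix i F = ∀ k → res k ≡ i → (F k → F (ℤ.suc k)) × (F (ℤ.suc k) → F k)

  Asc-resp : ∀ {i F G} → F ≈ G → Asc i F → Asc i G
  Asc-resp e (k , r , p , q) = k , r , proj₁ (e k) p , q ∘ proj₂ (e _)

  Dsc-resp : ∀ {i F G} → F ≈ G → Dsc i F → Dsc i G
  Dsc-resp e (k , r , p , q) = k , r , p ∘ proj₂ (e k) , proj₁ (e _) q

  Fix-resp : ∀ {i F G} → F ≈ G → Fix i F → Fix i G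
  Fix-resp e fx k r = proj₁ (e _) ∘ proj₁ (fx k r) ∘ proj₂ (e _)
                    , proj₁ (e _) ∘ proj₂ (fx k r) ∘ proj₂ (e _)

  Dsc⇒Asc : ∀ {i} F → Dsc i F → Asc i (F ∘ σ i)
  Dsc⇒Asc F (k , r , p , q) = k , r , subst F (sym (σ-lower r)) q , p ∘ subst F (σ-upper r)

  Asc⇒Dsc : ∀ {i} F → Asc i F → Dsc i (F ∘ σ i)
  Asc⇒Dsc F (k , r , p , q) = k , r , q ∘ subst F (σ-lower r) , subst F (sym (σ-upper r)) p

  -- Below the witness of the ascent runner i is full, and above it runner i + 1 is empty. So an
  -- ascent and a descent of the same residue exclude each other.
  Asc⇒suc⇒ : ∀ {i F} → Closed F → Asc i F → ∀ k → res k ≡ i → F (ℤ.suc k) → F k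
  Asc⇒suc⇒ cl (j , r , Fj , ¬Fsj) k e Fsk with ℤ.≤-total k j
  ... | inj₁ k≤j = closed-≤ cl k≤j (trans e (sym r)) Fj
  ... | inj₂ j≤k = contradiction
    (closed-≤ cl (ℤ.suc-mono j≤k) (trans (res-suc≡ r) (sym (res-suc≡ e))) Fsk) ¬Fsj

  -- Local analysis of two residues

  module _ {i j} (far : Far i j) (F : Subset) where

    Dsc-far : Dsc i F → Dsc i (F ∘ σ j)
    Dsc-far (k , r , p , q) = k , r , p ∘ subst F (σ-far-lower far r) , subst F (sym (σ-far-upper far r)) q

    Fix-far : Fix i F → Fix i (F ∘ σ j)
    Fix-far fx k r = subst F (sym (σ-far-upper far r)) ∘ proj₁ (fx k r) ∘ subst F (σ-far-lower far r)
                   , subst F (sym (σ-far-lower far r)) ∘ proj₂ (fx k r) ∘ subst F (σ-far-upper far r)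

  -- For residues k, k + 1, k + 2 the sets F ∘ σ (next i) and F ∘ σ (next i) ∘ σ i
  -- (and the same with i and next i exchanged) are those obtained from F by
  -- permuting its values at k, k + 1 and k + 2.
  module _ (3≤n : 3 ≤ n) {i : Fin n} (F : Subset) {k : ℤ} (r : res k ≡ i) where
    private
      j = next n i
      F₀ = F k
      F₁ = F (ℤ.suc k)
      F₂ = F (ℤ.suc (ℤ.suc k))

    σj : (F₀ ≡ F (σ j k)) × (F₂ ≡ F (σ j (ℤ.suc k))) × (F₁ ≡ F (σ j (ℤ.suc (ℤ.suc k))))
    σj = sym (cong F (σ-next-below 3≤n r))
       , sym (cong F (σ-lower (res-suc≡ r)))
       , sym (cong F (σ-upper (res-suc≡ r)))

    σi : (F₁ ≡ F (σ i k)) × (F₀ ≡ F (σ i (ℤ.suc k))) × (F₂ ≡ F (σ i (ℤ.suc (ℤ.suc k))))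
    σi = sym (cong F (σ-lower r)) , sym (cong F (σ-upper r)) , sym (cong F (σ-above-next 3≤n r))

  private
    Dsc-cast : ∀ {i A B} F k → res k ≡ i → A ≡ F k → B ≡ F (ℤ.suc k) → ¬ A → B → Dsc i F
    Dsc-cast F k r refl refl ¬a b = k , r , ¬a , b

    Fix-cast : ∀ {A B C D : Set} → A ≡ C → B ≡ D → (A → B) × (B → A) → (C → D) × (D → C)
    Fix-cast refl refl p = p

  -- Two adjacent descents make three consecutive runners strictly increasing in height. The
  -- patterns empty-full-full and empty-empty-full occur at the levels of the two jumps.
  Dsc-double : ∀ {F i} → Closed F → Dsc i F → Dsc (next n i) F →
    ∃ λ k → ∃ λ l → res k ≡ i × res l ≡ i ×
      (¬ F k × F (ℤ.suc k) × F (ℤ.suc (ℤ.suc k))) ×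
      (¬ F l × ¬ F (ℤ.suc l) × F (ℤ.suc (ℤ.suc l)))
  Dsc-double {F} cl (k , rk , ¬Fk , Fsk) (m , rm , ¬Fm , Fsm)
    with l , refl , rl ← res≡next⇒ m rm with ℤ.≤-total k l
  ... | inj₁ k≤l = k , l , rk , rl
      , (¬Fk , Fsk , closed-≤ cl (ℤ.suc-mono (ℤ.suc-mono k≤l))
                       (trans (res-suc≡ (res-suc≡ rk)) (sym (res-suc≡ (res-suc≡ rl)))) Fsm)
      , ((λ Fl → ¬Fk (closed-≤ cl k≤l (trans rk (sym rl)) Fl)) , ¬Fm , Fsm)
  ... | inj₂ l≤k = contradiction
      (closed-≤ cl (ℤ.suc-mono l≤k) (trans (res-suc≡ rl) (sym (res-suc≡ rk))) Fsk) ¬Fm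

  module _ (3≤n : 3 ≤ n) {i j : Fin n} (F : Subset) where

    Dsc-braid : Adjacent n i j → Closed F → Dsc i F → Dsc j F →
      Dsc i (F ∘ σ j) × Dsc j (F ∘ σ j ∘ σ i)
    Dsc-braid (inj₁ refl) cl di dj
      with k , l , rk , rl , (¬F₀ , F₁ , F₂) , _ ← Dsc-double cl di dj
      with e₀ , e₁ , e₂ ← σj 3≤n F rk
      with f₀ , f₁ , f₂ ← σi 3≤n (F ∘ σ j) rk
      = Dsc-cast (F ∘ σ j) k rk e₀ e₁ ¬F₀ F₂
      , Dsc-cast (F ∘ σ j ∘ σ i) (ℤ.suc k) (res-suc≡ rk) (trans e₀ f₁) (trans e₂ f₂) ¬F₀ F₁
    Dsc-braid (inj₂ refl) cl di dj
      with k , l , rk , rl , (¬F₀ , F₁ , F₂) , (_ , ¬G₁ , G₂) ← Dsc-double cl dj di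
      with e₀ , e₁ , e₂ ← σi 3≤n F rk
      with e₀′ , e₁′ , e₂′ ← σi 3≤n F rl
      with f₀ , f₁ , f₂ ← σj 3≤n (F ∘ σ j) rl
      = Dsc-cast (F ∘ σ j) (ℤ.suc k) (res-suc≡ rk) e₁ e₂ ¬F₀ F₂
      , Dsc-cast (F ∘ σ j ∘ σ i) l rl (trans e₀′ f₀) (trans e₂′ f₁) ¬G₁ G₂

    -- Of the three runners involved, two neighbours have equal height and the third differs. The
    -- two swaps carry the third runner across the equal pair, which ends up at the positions
    -- compared by `j`.
    Fix-braid : Adjacent n i j → Fix i F → Dsc j F →
      Dsc i (F ∘ σ j) × Fix j (F ∘ σ j ∘ σ i)
    Fix-braid (inj₁ refl) fx (m , rm , ¬F₁ , F₂)
      with k , refl , rk ← res≡next⇒ m rm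
      with e₀ , e₁ , e₂ ← σj 3≤n F rk
      = Dsc-cast (F ∘ σ j) k rk e₀ e₁ (¬F₁ ∘ proj₁ (fx k rk)) F₂ , fix
      where
      fix : Fix j (F ∘ σ j ∘ σ i)
      fix m rm
        with k , refl , rk ← res≡next⇒ m rm
        with e₀ , e₁ , e₂ ← σj 3≤n F rk
        with f₀ , f₁ , f₂ ← σi 3≤n (F ∘ σ j) rk
        = Fix-cast (trans e₀ f₁) (trans e₂ f₂) (fx k rk)
    Fix-braid (inj₂ refl) fx (k , rk , ¬F₀ , F₁)
      with e₀ , e₁ , e₂ ← σi 3≤n F rk
      = Dsc-cast (F ∘ σ j) (ℤ.suc k) (res-suc≡ rk) e₁ e₂ ¬F₀ (proj₁ (fx _ (res-suc≡ rk)) F₁) , fix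
      where
      fix : Fix j (F ∘ σ j ∘ σ i)
      fix k rk
        with e₀ , e₁ , e₂ ← σi 3≤n F rk
        with f₀ , f₁ , f₂ ← σj 3≤n (F ∘ σ j) rk
        = Fix-cast (trans e₀ f₀) (trans e₂ f₁) (fx _ (res-suc≡ rk))

  module _ (n<3 : ¬ (3 ≤ n)) {F : Subset} (cl : Closed F) where

    -- With only two runners, a rise from one to the other followed by a rise back would put a bead
    -- above a gap on the same runner. This is why the braid relation, absent for n = 2, is never
    -- called for.
    ¬Dsc×Dsc-next : ∀ {i} → Dsc i F → Dsc (next n i) F → ∀ {A : Set} → A
    ¬Dsc×Dsc-next {i} (k , rk , ¬Fk , Fsk) (m , rm , ¬Fm , Fsm)
      with ℤ.≤-total m (ℤ.suc k)
    ... | inj₁ m≤sk = contradiction (closed-≤ cl m≤sk (trans rm (sym (res-suc≡ rk))) Fsk) ¬Fm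
    ... | inj₂ sk≤m = contradiction (closed-≤ cl
        (ℤ.≤-trans (ℤ.i≤suc[i] k) (ℤ.≤-trans sk≤m (ℤ.i≤suc[i] m)))
        (trans rk (sym (trans (res-suc≡ rm) (next²≡id n<3 i)))) Fsm) ¬Fk

    ¬Fix×Dsc-next : ∀ {i} → Fix i F → Dsc (next n i) F → ∀ {A : Set} → A
    ¬Fix×Dsc-next {i} fx (m , rm , ¬Fm , Fsm) = contradiction
      (closed-≤ cl (ℤ.≤-trans (ℤ.i≤suc[i] m) (ℤ.i≤suc[i] _))
        (sym (trans (res-suc≡ (res-suc≡ refl)) (next²≡id n<3 (res m))))
        (proj₁ (fx _ (trans (res-suc≡ rm) (next²≡id n<3 i))) Fsm)) ¬Fm

    Adjacent⇒next : ∀ {i j} → Adjacent n i j → j ≡ next n i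
    Adjacent⇒next (inj₁ e)    = e
    Adjacent⇒next (inj₂ refl) = sym (next²≡id n<3 _)

    ¬Dsc×Dsc : ∀ {i j} → Adjacent n i j → Dsc i F → Dsc j F → ∀ {A : Set} → A
    ¬Dsc×Dsc adj di dj with refl ← Adjacent⇒next adj = ¬Dsc×Dsc-next di dj

    ¬Fix×Dsc : ∀ {i j} → Adjacent n i j → Fix i F → Dsc j F → ∀ {A : Set} → A
    ¬Fix×Dsc adj fx dj with refl ← Adjacent⇒next adj = ¬Fix×Dsc-next fx dj

  -- Row lengths after adding the addable corners of a given residue

  FreeFrom : Maybe ℕ → Partition → ℕ → Set
  FreeFrom nothing  xs zero    = ⊤
  FreeFrom (just p) xs zero    = row xs 0 < p
  FreeFrom _        xs (suc s) = row xs (suc s) < row xs s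

  AddableFrom : Fin n → ℕ → Maybe ℕ → Partition → ℕ → Set
  AddableFrom i r prev xs s = residue n (r + s) (row xs s) ≡ i × FreeFrom prev xs s

  Grows : Set → ℕ → ℕ → Set
  Grows A x y = (A × y ≡ suc x) ⊎ (¬ A × y ≡ x)

  private
    FreeFrom-tail : ∀ {prev} x xs s → FreeFrom (just x) xs s ≡ FreeFrom prev (x ∷ xs) (suc s)
    FreeFrom-tail {nothing} x xs zero    = refl
    FreeFrom-tail {just _}  x xs zero    = refl
    FreeFrom-tail {nothing} x xs (suc s) = refl
    FreeFrom-tail {just _}  x xs (suc s) = refl

    ¬FreeFrom-[] : ∀ prev s → ¬ FreeFrom prev [] (suc s)
    ¬FreeFrom-[] nothing  s ()
    ¬FreeFrom-[] (just _) s ()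

    row-addResGo-[] : ∀ i r prev s → row (addResGo n i r prev []) (suc s) ≡ 0
    row-addResGo-[] i r nothing s with residue n r 0 F.≟ i
    ... | yes _ = refl
    ... | no _  = refl
    row-addResGo-[] i r (just zero) s = refl
    row-addResGo-[] i r (just (suc p)) s with residue n r 0 F.≟ i
    ... | yes _ = refl
    ... | no _  = refl

  row-addResGo : ∀ i r prev xs s →
    Grows (AddableFrom i r prev xs s) (row xs s) (row (addResGo n i r prev xs) s)
  row-addResGo i r prev [] (suc s) = inj₂ (¬FreeFrom-[] prev s ∘ proj₂ , row-addResGo-[] i r prev s)
  row-addResGo i r nothing [] zero rewrite +-identityʳ r with residue n r 0 F.≟ i
  ... | yes e = inj₁ ((e , tt) , refl)
  ... | no ≢i = inj₂ (≢i ∘ proj₁ , refl)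
  row-addResGo i r (just zero) [] zero = inj₂ ((λ { (_ , ()) }) , refl)
  row-addResGo i r (just (suc p)) [] zero rewrite +-identityʳ r with residue n r 0 F.≟ i
  ... | yes e = inj₁ ((e , s≤s z≤n) , refl)
  ... | no ≢i = inj₂ (≢i ∘ proj₁ , refl)
  row-addResGo i r nothing (x ∷ xs) zero rewrite +-identityʳ r with residue n r x F.≟ i
  ... | yes e = inj₁ ((e , tt) , refl)
  ... | no ≢i = inj₂ (≢i ∘ proj₁ , refl)
  row-addResGo i r (just p) (x ∷ xs) zero rewrite +-identityʳ r with x <? p | residue n r x F.≟ i
  ... | yes x<p | yes e = inj₁ ((e , x<p) , refl)
  ... | yes _   | no ≢i = inj₂ (≢i ∘ proj₁ , refl)
  ... | no x≮p  | _     = inj₂ (x≮p ∘ proj₂ , refl)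
  row-addResGo i r prev (x ∷ xs) (suc s) =
    subst₂ (λ t A → Grows (residue n t (row xs s) ≡ i × A) (row xs s) (row (addResGo n i (suc r) (just x) xs) s))
      (sym (+-suc r s)) (FreeFrom-tail {prev} x xs s) (row-addResGo i (suc r) (just x) xs s)

  Free : Partition → ℕ → Set
  Free = FreeFrom nothing

  Addable : Fin n → Partition → ℕ → Set
  Addable i μ s = residue n s (row μ s) ≡ i × Free μ s

  row-addRes : ∀ i μ s → Grows (Addable i μ s) (row μ s) (row (addRes n i μ) s)
  row-addRes i μ s = row-addResGo i 0 nothing μ s

  row≤row-addRes : ∀ i μ s → row μ s ≤ row (addRes n i μ) s
  row≤row-addRes i μ s with row-addRes i μ s
  ... | inj₁ (_ , e) = ≤-trans (n≤1+n _) (≤-reflexive (sym e))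
  ... | inj₂ (_ , e) = ≤-reflexive (sym e)

  -- Partitions by their rows

  Positive : Partition → Set
  Positive = All (0 <_)

  Antitone : Partition → Set
  Antitone μ = ∀ s → row μ (suc s) ≤ row μ s

  antitone-≤ : ∀ μ → Antitone μ → ∀ {s t} → s ≤ t → row μ t ≤ row μ s
  antitone-≤ μ anti {s} {t} s≤t with k , refl ← m≤n⇒∃[o]m+o≡n s≤t = go k
    where
    go : ∀ k → row μ (s + k) ≤ row μ s
    go zero    = ≤-reflexive (cong (row μ) (+-identityʳ s))
    go (suc k) = ≤-trans (≤-reflexive (cong (row μ) (+-suc s k))) (≤-trans (anti (s + k)) (go k))

  antitone-tail : ∀ {x xs} → Antitone (x ∷ xs) → Antitone xs
  antitone-tail anti s = anti (suc s)

  antitone⇒Linked : ∀ {μ} → Antitone μ → Linked (λ a b → b ≤ a) μ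
  antitone⇒Linked {[]}         anti = []
  antitone⇒Linked {x ∷ []}     anti = [-]
  antitone⇒Linked {x ∷ y ∷ xs} anti = anti 0 ∷ antitone⇒Linked (antitone-tail {x} anti)

  row-injective : ∀ {μ γ} → Positive μ → Positive γ → (∀ s → row μ s ≡ row γ s) → μ ≡ γ
  row-injective []        []        e = refl
  row-injective []        (q ∷ _)   e = contradiction (e 0) (<⇒≢ q)
  row-injective (p ∷ _)   []        e = contradiction (sym (e 0)) (<⇒≢ p)
  row-injective (p ∷ ps)  (q ∷ qs)  e = cong₂ _∷_ (e 0) (row-injective ps qs (e ∘ suc))

  row≡0 : ∀ μ {s} → length μ ≤ s → row μ s ≡ 0
  row≡0 []       _          = refl
  row≡0 (_ ∷ μ)  (s≤s le)   = row≡0 μ le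

  antitone-addRes : ∀ i {μ} → Antitone μ → Antitone (addRes n i μ)
  antitone-addRes i {μ} anti s with row-addRes i μ (suc s)
  ... | inj₁ ((_ , free) , e) = ≤-trans (≤-reflexive e) (≤-trans free (row≤row-addRes i μ s))
  ... | inj₂ (_ , e)          = ≤-trans (≤-reflexive e) (≤-trans (anti s) (row≤row-addRes i μ s))

  positive-addResGo : ∀ i r prev {xs} → Positive xs → Positive (addResGo n i r prev xs)
  positive-addResGo i r nothing {[]} [] with residue n r 0 F.≟ i
  ... | yes _ = s≤s z≤n ∷ []
  ... | no _  = []
  positive-addResGo i r (just zero) {[]} [] = []
  positive-addResGo i r (just (suc p)) {[]} [] with residue n r 0 F.≟ i
  ... | yes _ = s≤s z≤n ∷ []
  ... | no _  = []
  positive-addResGo i r prev {x ∷ xs} (p ∷ ps) =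
    ≤-trans p (grows (row-addResGo i r prev (x ∷ xs) 0)) ∷ positive-addResGo i (suc r) (just x) ps
    where
    grows : ∀ {A y} → Grows A x y → x ≤ y
    grows (inj₁ (_ , refl)) = n≤1+n x
    grows (inj₂ (_ , refl)) = ≤-refl

  ⊆ₚ-refl : ∀ μ → μ ⊆ₚ μ
  ⊆ₚ-refl _ _ = ≤-refl

  ⊆ₚ-trans : ∀ μ γ κ → μ ⊆ₚ γ → γ ⊆ₚ κ → μ ⊆ₚ κ
  ⊆ₚ-trans μ γ κ p q s = ≤-trans (p s) (q s)

  ⊆ₚ-addRes : ∀ i μ → μ ⊆ₚ addRes n i μ
  ⊆ₚ-addRes i μ = row≤row-addRes i μ

  -- A corner added to μ in a row where μ and γ agree is also addable to γ.
  addRes-mono : ∀ i μ γ → μ ⊆ₚ γ → addRes n i μ ⊆ₚ addRes n i γ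
  addRes-mono i μ γ μ⊆γ s with row-addRes i μ s | row-addRes i γ s
  ... | inj₂ (_ , e) | _ = ≤-trans (≤-reflexive e) (≤-trans (μ⊆γ s) (row≤row-addRes i γ s))
  ... | inj₁ (_ , e) | inj₁ (_ , e′) =
    ≤-trans (≤-reflexive e) (≤-trans (s≤s (μ⊆γ s)) (≤-reflexive (sym e′)))
  ... | inj₁ ((r , free) , e) | inj₂ (¬add , e′) with m≤n⇒m<n∨m≡n (μ⊆γ s)
  ... | inj₁ lt = ≤-trans (≤-reflexive e) (≤-trans lt (≤-reflexive (sym e′)))
  ... | inj₂ eq = contradiction (trans (cong (residue n s) (sym eq)) r , free′ s eq free) ¬add
    where
    free′ : ∀ s → row μ s ≡ row γ s → Free μ s → Free γ s
    free′ zero    _  _  = tt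
    free′ (suc s) eq lt = ≤-trans (≤-reflexive (cong suc (sym eq))) (≤-trans lt (μ⊆γ s))

  act-mono : ∀ u v w → act n v ⊆ₚ act n w → act n (u ++ v) ⊆ₚ act n (u ++ w)
  act-mono []      v w p = p
  act-mono (i ∷ u) v w p = addRes-mono i (act n (u ++ v)) (act n (u ++ w)) (act-mono u v w p)

  act-++-⊇ : ∀ u v → act n v ⊆ₚ act n (u ++ v)
  act-++-⊇ []      v = ⊆ₚ-refl (act n v)
  act-++-⊇ (i ∷ u) v = ⊆ₚ-trans (act n v) (act n (u ++ v)) (act n (i ∷ u ++ v))
    (act-++-⊇ u v) (⊆ₚ-addRes i (act n (u ++ v)))

  -- Beads

  -- The bead of row s is the content of the first cell to the right of that row.
  bead : Partition → ℕ → ℤ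
  bead μ s = row μ s ⊖ s

  Bead : Partition → Subset
  Bead μ k = ∃ λ s → bead μ s ≡ k

  module _ {μ} (anti : Antitone μ) where

    bead-injective : ∀ {s t} → bead μ s ≡ bead μ t → s ≡ t
    bead-injective {s} {t} e = go (≤-total s t)
      where
      eq : row μ s + t ≡ row μ t + s
      eq = ⊖-cancel (row μ s) s (row μ t) t e
      go : s ≤ t ⊎ t ≤ s → s ≡ t
      go (inj₁ s≤t) = ≤-antisym s≤t (+-cancelˡ-≤ (row μ s) t s
        (≤-trans (≤-reflexive eq) (+-monoˡ-≤ s (antitone-≤ μ anti s≤t))))
      go (inj₂ t≤s) = ≤-antisym (+-cancelˡ-≤ (row μ t) s t
        (≤-trans (≤-reflexive (sym eq)) (+-monoˡ-≤ t (antitone-≤ μ anti t≤s)))) t≤s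

    Free⇒¬Bead-suc : ∀ s → Free μ s → ¬ Bead μ (ℤ.suc (bead μ s))
    Free⇒¬Bead-suc s free (t , e) = go s free
      (⊖-cancel (row μ t) t (suc (row μ s)) s (trans e (suc-⊖ (row μ s) s))) (≤-total s t)
      where
      go : ∀ s → Free μ s → row μ t + s ≡ suc (row μ s) + t → s ≤ t ⊎ t ≤ s → _
      go s free e (inj₁ s≤t) = <⇒≢ (s≤s (+-mono-≤ (antitone-≤ μ anti s≤t) s≤t)) e
      go (suc s) free e (inj₂ t≤s) with m≤n⇒m<n∨m≡n t≤s
      ... | inj₂ refl = <⇒≢ (n<1+n _) (+-cancelʳ-≡ _ (row μ t) (suc (row μ t)) e)
      ... | inj₁ (s≤s t≤s′) = <⇒≢ (≤-trans (s≤s (+-mono-≤ (≤-trans free (antitone-≤ μ anti t≤s′)) t≤s′))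
        (≤-reflexive (sym (+-suc (row μ t) s)))) (sym e)
      go zero free e (inj₂ z≤n) = <⇒≢ (n<1+n _) (+-cancelʳ-≡ _ (row μ t) (suc (row μ t)) e)

  bead-flat : ∀ μ s → row μ (suc s) ≡ row μ s → bead μ s ≡ ℤ.suc (bead μ (suc s))
  bead-flat μ s e = begin
    row μ s ⊖ s                    ≡⟨ cong (_⊖ s) e ⟨
    row μ (suc s) ⊖ s              ≡⟨ ℤ.[1+m]⊖[1+n]≡m⊖n (row μ (suc s)) s ⟨
    suc (row μ (suc s)) ⊖ suc s    ≡⟨ suc-⊖ (row μ (suc s)) (suc s) ⟨
    ℤ.suc (bead μ (suc s))         ∎

  res-bead : ∀ μ s → res (bead μ s) ≡ residue n s (row μ s)
  res-bead μ s = res-⊖ (row μ s) s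

  Free? : ∀ μ s → Dec (Free μ s)
  Free? μ zero    = yes tt
  Free? μ (suc s) = row μ (suc s) <? row μ s

  Removable : Fin n → Partition → ℕ → Set
  Removable i μ s = residue n s (row μ s) ≡ next n i × row μ (suc s) < row μ s

  module _ {μ} (anti : Antitone μ) where

    ¬Free⇒Bead-suc : ∀ s → ¬ Free μ s → Bead μ (ℤ.suc (bead μ s))
    ¬Free⇒Bead-suc zero    ¬free = contradiction tt ¬free
    ¬Free⇒Bead-suc (suc s) ¬free = s , bead-flat μ s (≤-antisym (anti s) (≮⇒≥ ¬free))

    drop⇒¬Bead-pred : ∀ s {k} → row μ (suc s) < row μ s → bead μ s ≡ ℤ.suc k → ¬ Bead μ k
    drop⇒¬Bead-pred s {k} drop e (t , refl) = go (≤-<-connex t s)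
      where
      eq : suc (row μ t) + s ≡ row μ s + t
      eq = ⊖-cancel (suc (row μ t)) t (row μ s) s (trans (sym (suc-⊖ (row μ t) t)) (sym e))
      go : t ≤ s ⊎ s < t → _
      go (inj₁ t≤s) = <⇒≢ (s≤s (+-mono-≤ (antitone-≤ μ anti t≤s) t≤s)) (sym eq)
      go (inj₂ s<t) = <⇒≢ (+-mono-≤-< (≤-trans (s≤s (antitone-≤ μ anti s<t)) drop) s<t) eq

    Addable⇒Asc : ∀ {i s} → Addable i μ s → Asc i (Bead μ)
    Addable⇒Asc {s = s} (r , free) =
      bead μ s , trans (res-bead μ s) r , (s , refl) , Free⇒¬Bead-suc anti s free

    Asc⇒Addable : ∀ {i} → Asc i (Bead μ) → ∃ (Addable i μ)
    Asc⇒Addable (_ , r , (s , refl) , ¬suc) with Free? μ s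
    ... | yes free = s , trans (sym (res-bead μ s)) r , free
    ... | no ¬free = contradiction (¬Free⇒Bead-suc s ¬free) ¬suc

    Removable⇒Dsc : ∀ {i s} → Removable i μ s → Dsc i (Bead μ)
    Removable⇒Dsc {s = s} (r , drop) with k , e , rk ← res≡next⇒ _ (trans (res-bead μ s) r) =
      k , rk , drop⇒¬Bead-pred s drop e , (s , e)

    Asc-Fix-Dsc : ∀ i → Asc i (Bead μ) ⊎ Fix i (Bead μ) ⊎ Dsc i (Bead μ)
    Asc-Fix-Dsc i
      -- Row `length μ` is the first empty one. A corner can still be added there, but none can be
      -- removed, hence the two different search bounds.
      with anyUpTo? (λ s → (residue n s (row μ s) F.≟ i) ×-dec Free? μ s) (suc (length μ))
    ... | yes (_ , _ , add) = inj₁ (Addable⇒Asc add)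
    ... | no ¬add
      with anyUpTo? (λ s → (residue n s (row μ s) F.≟ next n i) ×-dec (row μ (suc s) <? row μ s)) (length μ)
    ... | yes (_ , _ , rem) = inj₂ (inj₂ (Removable⇒Dsc rem))
    ... | no ¬rem = inj₂ (inj₁ λ k r → up r , down r)
      where
      row≢0⇒<length : ∀ {s x} → x < row μ s → s < length μ
      row≢0⇒<length {s} lt with s <? length μ
      ... | yes p = p
      ... | no ¬p = contradiction (≤-trans lt (≤-reflexive (row≡0 μ (≮⇒≥ ¬p)))) λ ()
      bound : ∀ s → Free μ s → s < suc (length μ)
      bound zero    _  = s≤s z≤n
      bound (suc s) lt = s≤s (row≢0⇒<length lt)
      up : ∀ {k} → res k ≡ i → Bead μ k → Bead μ (ℤ.suc k)
      up r (s , refl) = ¬Free⇒Bead-suc s λ free →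
        ¬add (s , bound s free , trans (sym (res-bead μ s)) r , free)
      down : ∀ {k} → res k ≡ i → Bead μ (ℤ.suc k) → Bead μ k
      down {k} r (s , e) with row μ (suc s) <? row μ s
      ... | yes lt = contradiction
        (s , row≢0⇒<length lt , trans (sym (res-bead μ s)) (trans (cong res e) (res-suc≡ r)) , lt) ¬rem
      ... | no ≮ = suc s , suc-injectiveℤ
        (trans (sym (bead-flat μ s (≤-antisym (anti s) (≮⇒≥ ≮)))) e)

    -- A bead at k ≡ i moves up if k + 1 is free, and if both places are full the swap changes
    -- nothing. The hypothesis excludes a bead at k + 1 with k free, which `σ i` would lower while
    -- `addRes` leaves it in place.
    Bead-addRes : ∀ i → (∀ k → res k ≡ i → Bead μ (ℤ.suc k) → Bead μ k) →
      Bead (addRes n i μ) ≈ Bead μ ∘ σ i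
    Bead-addRes i down k = to , from (position i k)
      where
      bead-grow : ∀ {s} → row (addRes n i μ) s ≡ suc (row μ s) → bead (addRes n i μ) s ≡ ℤ.suc (bead μ s)
      bead-grow {s} e = trans (cong (_⊖ s) e) (sym (suc-⊖ (row μ s) s))
      bead-same : ∀ {s} → row (addRes n i μ) s ≡ row μ s → bead (addRes n i μ) s ≡ bead μ s
      bead-same {s} e = cong (_⊖ s) e
      stay : ∀ s → ¬ Addable i μ s → ∀ {b} → Position i b → bead μ s ≡ b → Bead μ (σ i b)
      stay s ¬add (lower r) refl = subst (Bead μ) (sym (σ-lower r))
        (¬Free⇒Bead-suc s λ free → ¬add (trans (sym (res-bead μ s)) r , free))
      stay s ¬add (upper r) e = subst (Bead μ) (sym (σ-upper r)) (down _ r (s , e))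
      stay s ¬add (other p q) e = s , trans e (sym (σ-other p q))
      to : Bead (addRes n i μ) k → Bead μ (σ i k)
      to (s , e) with row-addRes i μ s
      ... | inj₁ ((r , _) , g) = subst (Bead μ ∘ σ i) (trans (sym (bead-grow g)) e)
              (s , sym (σ-upper (trans (res-bead μ s) r)))
      ... | inj₂ (¬add , g) = stay s ¬add (position i k) (trans (sym (bead-same g)) e)
      from : ∀ {k} → Position i k → Bead μ (σ i k) → Bead (addRes n i μ) k
      from {k} (lower r) b with s , refl ← down k r (subst (Bead μ) (σ-lower r) b) with row-addRes i μ s
      ... | inj₁ ((_ , free) , _) = contradiction (subst (Bead μ) (σ-lower r) b) (Free⇒¬Bead-suc anti s free)
      ... | inj₂ (_ , g)          = s , bead-same g
      from (upper {k} r) b with s , refl ← subst (Bead μ) (σ-upper r) b with row-addRes i μ s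
      ... | inj₁ (_ , g)    = s , bead-grow g
      ... | inj₂ (¬add , _) with t , e ← ¬Free⇒Bead-suc s (λ free → ¬add (trans (sym (res-bead μ s)) r , free))
                            with row-addRes i μ t
      ... | inj₁ ((r′ , _) , _) = contradiction
              (trans (sym (res-suc≡ r)) (trans (cong res (sym e)) (trans (res-bead μ t) r′))) (next≢id i)
      ... | inj₂ (_ , g)        = t , trans (bead-same g) e
      from (other p q) b with s , refl ← subst (Bead μ) (σ-other p q) b with row-addRes i μ s
      ... | inj₁ ((r , _) , _) = contradiction (trans (res-bead μ s) r) p
      ... | inj₂ (_ , g)       = s , bead-same g

  private
    -- The bead of row s of μ must occur in γ in some row t ≥ s, because the rows before s carry the
    -- same beads in both partitions.
    row-≤ : ∀ {μ γ} → Antitone μ → Antitone γ → Bead μ ≈ Bead γ →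
      ∀ s → (∀ t → t < s → row μ t ≡ row γ t) → row μ s ≤ row γ s
    row-≤ {μ} {γ} aμ aγ e s below with t , eq ← proj₁ (e (bead μ s)) (s , refl) with t <? s
    ... | yes t<s = contradiction
      (bead-injective {μ} aμ (trans (cong (_⊖ t) (below t t<s)) eq)) (<⇒≢ t<s)
    ... | no t≮s = +-cancelʳ-≤ t (row μ s) (row γ s)
      (≤-trans (≤-reflexive (sym (⊖-cancel (row γ t) t (row μ s) s eq)))
               (+-mono-≤ (antitone-≤ γ aγ (≮⇒≥ t≮s)) (≮⇒≥ t≮s)))

  Bead-injective : ∀ {μ γ} → Antitone μ → Antitone γ → Bead μ ≈ Bead γ → ∀ s → row μ s ≡ row γ s
  Bead-injective {μ} {γ} aμ aγ e s = below (suc s) s ≤-refl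
    where
    below : ∀ s t → t < s → row μ t ≡ row γ t
    below (suc s) t (s≤s t≤s) = ≤-antisym
      (row-≤ {μ} {γ} aμ aγ e t (λ r r<t → below s r (≤-trans r<t t≤s)))
      (row-≤ {γ} {μ} aγ aμ (≈-sym e) t (λ r r<t → sym (below s r (≤-trans r<t t≤s))))

  -- Cores, and words each of whose letters adds cells

  -- The hook condition is replaced by closedness of the bead set, which is directly preserved by
  -- the maps `σ i`.
  record Core (μ : Partition) : Set where
    field
      positive : Positive μ
      antitone : Antitone μ
      closed   : Closed (Bead μ)

  open Core

  Core-≡ : ∀ {μ γ} → Core μ → Core γ → Bead μ ≈ Bead γ → μ ≡ γ
  Core-≡ {μ} {γ} cμ cγ e = row-injective (positive cμ) (positive cγ)
    (Bead-injective {μ} {γ} (antitone cμ) (antitone cγ) e)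

  Core-[] : Core []
  Core-[] = record
    { positive = []
    ; antitone = λ _ → ≤-refl
    ; closed   = closed-[]
    }
    where
    closed-[] : Closed (Bead [])
    closed-[] k (s , e) with c , r , refl ← ⊖-surjective k = s + n , ⊖-cong 0 (s + n) c r
      (trans (⊖-cancel 0 s (c + n) r (trans e (ℤ.distribˡ-⊖-+-pos n c r)))
        (trans (+-assoc c n s) (cong (_+_ c) (+-comm n s))))

  ¬Dsc-[] : ∀ {i} → ¬ Dsc i (Bead [])
  ¬Dsc-[] (k , _ , ¬bead , (s , e)) = ¬bead
    (suc s , suc-injectiveℤ (trans (suc-⊖ 0 (suc s)) (trans (ℤ.[1+m]⊖[1+n]≡m⊖n 0 s) e)))

  ¬Fix-0-[] : ∀ {i} → Fix i (Bead []) → toℕ i ≢ 0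
  ¬Fix-0-[] {i} fx i≡0 with s , e ← proj₁ (fx (+ 0) (trans (cong (res ∘ +_) (sym i≡0)) (res-toℕ i))) (0 , refl) =
    contradiction (⊖-cancel 0 s 1 0 e) λ ()

  Bead-addRes-Asc : ∀ {i μ} → Core μ → Asc i (Bead μ) → Bead (addRes n i μ) ≈ Bead μ ∘ σ i
  Bead-addRes-Asc {i} {μ} c asc = Bead-addRes {μ} (antitone c) i (Asc⇒suc⇒ (closed c) asc)

  Core-addRes : ∀ {i μ} → Core μ → Asc i (Bead μ) → Core (addRes n i μ)
  Core-addRes {i} {μ} c asc = record
    { positive = positive-addResGo i 0 nothing (positive c)
    ; antitone = antitone-addRes i {μ} (antitone c)
    ; closed   = λ k → proj₂ (e k) ∘ closed-σ {Bead μ} i (closed c) k ∘ proj₁ (e (k ℤ.+ + n))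
    }
    where e = Bead-addRes-Asc c asc

  data Up : Word n → Partition → Set where
    []   : Up [] []
    step : ∀ {i w μ} → Asc i (Bead μ) → Up w μ → Up (i ∷ w) (addRes n i μ)

  Up⇒Core : ∀ {w μ} → Up w μ → Core μ
  Up⇒Core []            = Core-[]
  Up⇒Core (step asc up) = Core-addRes (Up⇒Core up) asc

  Up⇒act : ∀ {w μ} → Up w μ → act n w ≡ μ
  Up⇒act []                = refl
  Up⇒act (step {i} asc up) = cong (addRes n i) (Up⇒act up)

  Up-suffix : ∀ u {w μ} → Up (u ++ w) μ → Up w (act n w)
  Up-suffix [] up rewrite Up⇒act up = up
  Up-suffix (i ∷ u) (step _ up) = Up-suffix u up

  ∘σ-involutive : ∀ i F → F ∘ σ i ∘ σ i ≈ F
  ∘σ-involutive i F = ≡⇒≈ F (σ-involutive i)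

  ∘-≈ : ∀ {F G} i → F ≈ G → F ∘ σ i ≈ G ∘ σ i
  ∘-≈ i e k = e (σ i k)

  module _ {i μ} (c : Core μ) (asc : Asc i (Bead μ)) where

    Dsc-addRes : Dsc i (Bead (addRes n i μ))
    Dsc-addRes = Dsc-resp (≈-sym (Bead-addRes-Asc c asc)) (Asc⇒Dsc (Bead μ) asc)

    Bead-addRes-inverse : Bead μ ≈ Bead (addRes n i μ) ∘ σ i
    Bead-addRes-inverse = ≈-trans (≈-sym (∘σ-involutive i (Bead μ)))
      (∘-≈ i (≈-sym (Bead-addRes-Asc c asc)))

  -- Builds a core with a prescribed bead set `F`. In the exchange argument the bead sets are known
  -- in advance, the partitions are not.
  Up-∷ : ∀ {i w κ} F → Up w κ → Bead κ ≈ F ∘ σ i → Dsc i F →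
    Up (i ∷ w) (addRes n i κ) × Bead (addRes n i κ) ≈ F
  Up-∷ {i} F up e dsc = step asc up
    , ≈-trans (Bead-addRes-Asc (Up⇒Core up) asc) (≈-trans (∘-≈ i e) (∘σ-involutive i F))
    where asc = Asc-resp (≈-sym e) (Dsc⇒Asc F dsc)

  ~-∷ : ∀ i {u v : Word n} → u ~[ n ] v → (i ∷ u) ~[ n ] (i ∷ v)
  ~-∷ i = ~-++ˡ (i ∷ [])

  Adjacent? : ∀ i j → Dec (Adjacent n i j)
  Adjacent? i j = (j F.≟ next n i) ⊎-dec (i F.≟ next n j)

  Adjacent-sym : ∀ {i j} → Adjacent n i j → Adjacent n j i
  Adjacent-sym (inj₁ e) = inj₂ e
  Adjacent-sym (inj₂ e) = inj₁ e

  σ-braid-Adjacent : 3 ≤ n → ∀ {i j} → Adjacent n i j → ∀ k → σ i (σ j (σ i k)) ≡ σ j (σ i (σ j k))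
  σ-braid-Adjacent 3≤n {i}     (inj₁ refl) k = σ-braid 3≤n i k
  σ-braid-Adjacent 3≤n {j = j} (inj₂ refl) k = sym (σ-braid 3≤n j k)

  -- The exchange property and its consequences for words of a core

  Exchange : Fin n → Word n → Partition → Set
  Exchange i w μ = ∃ λ v → ∃ λ κ →
    Up v κ × Bead κ ≈ Bead μ ∘ σ i × (i ∷ v) ~[ n ] w × suc (length v) ≡ length w

  private
    -- If the first letter j of the word commutes with i, the induction passes through it. If they
    -- are adjacent, both are descents and exchanging twice rewrites the word as j i j v₂, which a
    -- braid turns into i j i v₂. The second exchange is applied to a word produced by the first, so
    -- the recursion runs on a length bound.
    exchange-≤ : ∀ m {i w μ} → length w ≤ m → Up w μ → Dsc i (Bead μ) → Exchange i w μ
    exchange-≤ m _ [] dsc = contradiction dsc ¬Dsc-[]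
    exchange-≤ (suc m) {i} (s≤s le) up@(step {j} {w} {μ₁} asc up₁) dsc with i F.≟ j
    ... | yes refl = w , μ₁ , up₁ , Bead-addRes-inverse (Up⇒Core up₁) asc , ~refl , refl
    ... | no i≢j with Adjacent? i j
    ... | no ¬adj =
      let μ = addRes n j μ₁
          far = i≢j , ¬adj
          inv = Bead-addRes-inverse (Up⇒Core up₁) asc
          v , κ , upᵥ , e , v~ , len = exchange-≤ m le up₁
            (Dsc-resp (≈-sym inv) (Dsc-far far (Bead μ) dsc))
          up′ , e′ = Up-∷ (Bead μ ∘ σ i) upᵥ
            (≈-trans e (≈-trans (∘-≈ i inv) (≡⇒≈ (Bead μ) (λ k → sym (σ-commute far k)))))
            (Dsc-far (Far-sym far) (Bead μ) (Dsc-addRes (Up⇒Core up₁) asc))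
      in j ∷ v , _ , up′ , e′ , ~trans (~-commute ¬adj v) (~-∷ j v~) , cong suc len
    ... | yes adj with 3 ≤? n
    ... | no n<3 = ¬Dsc×Dsc n<3 (closed (Up⇒Core up)) adj dsc (Dsc-addRes (Up⇒Core up₁) asc)
    ... | yes 3≤n =
      let μ = addRes n j μ₁
          cμ = closed (Up⇒Core up)
          inv = Bead-addRes-inverse (Up⇒Core up₁) asc
          dscⱼ = Dsc-addRes (Up⇒Core up₁) asc
          d₁ , d₂ = Dsc-braid 3≤n (Bead μ) adj cμ dsc dscⱼ
          d₁′ , d₂′ = Dsc-braid 3≤n (Bead μ) (Adjacent-sym adj) cμ dscⱼ dsc
          v₁ , κ₁ , up₁′ , e₁ , v₁~ , len₁ = exchange-≤ m le up₁ (Dsc-resp (≈-sym inv) d₁)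
          e₁′ = ≈-trans e₁ (∘-≈ i inv)
          v₂ , κ₂ , up₂ , e₂ , v₂~ , len₂ = exchange-≤ m
            (≤-trans (n≤1+n _) (≤-trans (≤-reflexive len₁) le)) up₁′ (Dsc-resp (≈-sym e₁′) d₂)
          upᵢ , eᵢ = Up-∷ (Bead μ ∘ σ i ∘ σ j) up₂
            (≈-trans e₂ (≈-trans (∘-≈ j e₁′)
              (≡⇒≈ (Bead μ) (λ k → sym (σ-braid-Adjacent 3≤n adj k))))) d₂′
          upⱼ , eⱼ = Up-∷ (Bead μ ∘ σ i) upᵢ eᵢ d₁′
      in j ∷ i ∷ v₂ , _ , upⱼ , eⱼ
         , ~trans (~-braid 3≤n adj v₂) (~-∷ j (~trans (~-∷ i v₂~) v₁~))
         , cong suc (trans (cong suc len₂) len₁)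

  exchange : ∀ {i w μ} → Up w μ → Dsc i (Bead μ) → Exchange i w μ
  exchange = exchange-≤ _ ≤-refl

  Up-[] : ∀ {w μ} → Up w μ → μ ≡ [] → w ≡ []
  Up-[] []            _ = refl
  Up-[] (step {i} asc up) e =
    contradiction (subst (Dsc i ∘ Bead) e (Dsc-addRes (Up⇒Core up) asc)) ¬Dsc-[]

  -- The first letter of one word is a descent of the core, so the exchange brings it to the front
  -- of the other. What remains are two words of the same smaller core.
  Up-unique : ∀ {w w′ μ} → Up w μ → Up w′ μ → w ~[ n ] w′ × length w ≡ length w′
  Up-unique [] up′ with refl ← Up-[] up′ refl = ~refl , refl
  Up-unique (step {i} asc up) up′
    with v , κ , upᵥ , e , v~ , len ← exchange up′ (Dsc-addRes (Up⇒Core up) asc)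
    with refl ← Core-≡ (Up⇒Core upᵥ) (Up⇒Core up)
                  (≈-trans e (≈-sym (Bead-addRes-inverse (Up⇒Core up) asc)))
    with w~ , len′ ← Up-unique up upᵥ
    = ~trans (~-∷ i w~) v~ , trans (cong suc len′) len

  private
    -- A generator that fixes the core stabilises the coset of w, and can be carried through w to
    -- become a generator of the parabolic subgroup. Past an adjacent letter j, the exchange writes
    -- the word as j i v, and i j i v = j i j v leaves the letter j to be carried through v.
    Fix⇒~-≤ : ∀ m {i w μ} → length w ≤ m → Up w μ → Fix i (Bead μ) →
      ∃ λ j → toℕ j ≢ 0 × (i ∷ w) ~[ n ] (w ++ j ∷ [])
    Fix⇒~-≤ m {i} _ [] fx = i , ¬Fix-0-[] fx , ~refl
    Fix⇒~-≤ (suc m) {i} (s≤s le) up@(step {j} {w} {μ₁} asc up₁) fx with i F.≟ j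
    ... | yes refl with k , r , ¬b , b ← Dsc-addRes (Up⇒Core up₁) asc = contradiction (proj₂ (fx k r) b) ¬b
    Fix⇒~-≤ (suc m) {i} (s≤s le) up@(step {j} {w} {μ₁} asc up₁) fx | no i≢j with Adjacent? i j
    ... | no ¬adj =
      let l , l≢0 , e = Fix⇒~-≤ m le up₁ (Fix-resp (≈-sym (Bead-addRes-inverse (Up⇒Core up₁) asc))
                          (Fix-far (i≢j , ¬adj) (Bead (addRes n j μ₁)) fx))
      in l , l≢0 , ~trans (~-commute ¬adj w) (~-∷ j e)
    ... | yes adj with 3 ≤? n
    ... | no n<3 = ¬Fix×Dsc n<3 (closed (Up⇒Core up)) adj fx (Dsc-addRes (Up⇒Core up₁) asc)
    ... | yes 3≤n =
      let inv = Bead-addRes-inverse (Up⇒Core up₁) asc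
          d , f = Fix-braid 3≤n (Bead (addRes n j μ₁)) adj fx (Dsc-addRes (Up⇒Core up₁) asc)
          v , κ , upᵥ , e , v~ , len = exchange up₁ (Dsc-resp (≈-sym inv) d)
          l , l≢0 , v~′ = Fix⇒~-≤ m (≤-trans (n≤1+n _) (≤-trans (≤-reflexive len) le)) upᵥ
                            (Fix-resp (≈-sym (≈-trans e (∘-≈ i inv))) f)
      in l , l≢0 , ~trans (~-∷ i (~-∷ j (~sym v~))) (~trans (~-braid 3≤n adj v)
           (~trans (~-∷ j (~-∷ i v~′)) (~-∷ j (~-++ʳ (l ∷ []) v~))))

  Fix⇒~ : ∀ {i w μ} → Up w μ → Fix i (Bead μ) →
    ∃ λ j → toℕ j ≢ 0 × (i ∷ w) ~[ n ] (w ++ j ∷ [])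
  Fix⇒~ = Fix⇒~-≤ _ ≤-refl

  Fix⇒≈ : ∀ {i F} → Fix i F → F ≈ F ∘ σ i
  Fix⇒≈ {i} {F} fx k with position i k
  ... | lower r   = subst F (sym (σ-lower r)) ∘ proj₁ (fx k r) , proj₂ (fx k r) ∘ subst F (σ-lower r)
  ... | upper r   = subst F (sym (σ-upper r)) ∘ proj₂ (fx _ r) , proj₁ (fx _ r) ∘ subst F (σ-upper r)
  ... | other p q = subst F (sym (σ-other p q)) , subst F (σ-other p q)

  -- Shortest coset representatives

  -- Reading u from the right, an ascent keeps the letter, a fixed set lets the parabolic subgroup
  -- absorb it, and a descent cancels it against an earlier one.
  normalise : ∀ u → ∃ λ v → ∃ λ μ → Up v μ × length v ≤ length u × Bead μ ≈ Bead [] ∘ perm u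
  normalise [] = [] , [] , [] , ≤-refl , λ k → (λ b → b) , (λ b → b)
  normalise (i ∷ u) with v , μ , up , le , e ← normalise u with Asc-Fix-Dsc {μ} (antitone (Up⇒Core up)) i
  ... | inj₁ asc = i ∷ v , _ , step asc up , s≤s le
      , ≈-trans (Bead-addRes-Asc (Up⇒Core up) asc) (∘-≈ i e)
  ... | inj₂ (inj₁ fx) = v , μ , up , ≤-trans le (n≤1+n _) , ≈-trans (Fix⇒≈ fx) (∘-≈ i e)
  ... | inj₂ (inj₂ dsc) with v′ , κ , up′ , e′ , _ , len ← exchange up dsc =
      v′ , κ , up′ , ≤-trans (n≤1+n _) (≤-trans (≤-reflexive len) (≤-trans le (n≤1+n _)))
      , ≈-trans e′ (∘-≈ i e)

  Up⇒perm : ∀ {w μ} → Up w μ → Bead μ ≈ Bead [] ∘ perm w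
  Up⇒perm []                = λ k → (λ b → b) , (λ b → b)
  Up⇒perm (step {i} asc up) = ≈-trans (Bead-addRes-Asc (Up⇒Core up) asc) (∘-≈ i (Up⇒perm up))

  -- The competing word u need only give the same bead set, that is, lie in the same coset.
  -- Reducedness and the Grassmannian property are both instances of this bound.
  Up-perm-minimal : ∀ {w μ} → Up w μ → ∀ u → Bead [] ∘ perm u ≈ Bead μ → length w ≤ length u
  Up-perm-minimal up u e
    with v , κ , upᵥ , le , eᵥ ← normalise u
    with refl ← Core-≡ (Up⇒Core upᵥ) (Up⇒Core up) (≈-trans eᵥ e)
    = ≤-trans (≤-reflexive (proj₂ (Up-unique up upᵥ))) le

  Up-~ : ∀ {w w′ μ μ′} → w ~[ n ] w′ → Up w μ → Up w′ μ′ → μ ≡ μ′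
  Up-~ w~ up up′ = Core-≡ (Up⇒Core up) (Up⇒Core up′)
    (≈-trans (Up⇒perm up) (≈-trans (≡⇒≈ (Bead []) (perm-~ w~)) (≈-sym (Up⇒perm up′))))

  Up⇒Reduced : ∀ {w μ} → Up w μ → Reduced n w
  Up⇒Reduced up u u~w = Up-perm-minimal up u
    (≈-trans (≡⇒≈ (Bead []) (perm-~ u~w)) (≈-sym (Up⇒perm up)))

  Fix-[] : ∀ {i} → toℕ i ≢ 0 → Fix i (Bead [])
  Fix-[] {i} i≢0 with Asc-Fix-Dsc {[]} (λ _ → ≤-refl) i
  ... | inj₂ (inj₁ fx)  = fx
  ... | inj₂ (inj₂ dsc) = contradiction dsc ¬Dsc-[]
  ... | inj₁ asc with Asc⇒Addable {[]} (λ _ → ≤-refl) asc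
  ... | suc _ , _ , ()
  ... | zero , e , _ = contradiction (begin
    toℕ i                  ≡⟨ cong toℕ e ⟨
    toℕ (residue n 0 0)    ≡⟨ toℕ-residue 0 0 ⟩
    (n ∸ 1) * 0 % n        ≡⟨ cong (_% n) (*-zeroʳ (n ∸ 1)) ⟩
    0 % n                  ≡⟨ m<n⇒m%n≡m (≤-trans (s≤s z≤n) 2≤n) ⟩
    0                      ∎) i≢0

  perm-parabolic : ∀ {u} → All (λ i → toℕ i ≢ 0) u → Bead [] ∘ perm u ≈ Bead []
  perm-parabolic []            k = (λ b → b) , (λ b → b)
  perm-parabolic {i ∷ u} (p ∷ ps) = ≈-trans (∘-≈ i (perm-parabolic ps)) (≈-sym (Fix⇒≈ (Fix-[] p)))

  Up⇒Grassmannian : ∀ {w μ} → Up w μ → Grassmannian n w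
  Up⇒Grassmannian {w} {μ} up u par v v~ = w , ~refl , Up-perm-minimal up v
    (≈-trans (≡⇒≈ (Bead []) (λ k → trans (perm-~ v~ k) (perm-++ w u k)))
    (≈-trans (λ k → perm-parabolic par (perm w k)) (≈-sym (Up⇒perm up))))

  Reduced-tail : ∀ {i w} → Reduced n (i ∷ w) → Reduced n w
  Reduced-tail {i} red u u~w = ≤-pred (red (i ∷ u) (~-∷ i u~w))

  Reduced-prefix : ∀ u {w} → Reduced n (u ++ w) → Reduced n u
  Reduced-prefix u {w} red v v~u = +-cancelʳ-≤ (length w) (length u) (length v)
    (subst₂ _≤_ (length-++ u) (length-++ v) (red (v ++ w) (~-++ʳ w v~u)))

  -- A first letter that adds no cell is impossible: if it fixes the core, then w alone represents
  -- the same coset; if it is a descent, it cancels against w.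
  Reduced×Grassmannian⇒Up : ∀ w → Reduced n w → Grassmannian n w → Up w (act n w)
  Reduced×Grassmannian⇒Up [] _ _ = []
  Reduced×Grassmannian⇒Up (i ∷ w) red gr = go (Asc-Fix-Dsc {act n w} (antitone (Up⇒Core up)) i)
    where
    up : Up w (act n w)
    up = Reduced×Grassmannian⇒Up w (Reduced-tail red) λ u par v v~ →
      let x , x~ , le = gr u par (i ∷ v) (~-∷ i v~)
      in w , ~refl , ≤-pred (≤-trans (red x x~) le)
    go : Asc i (Bead (act n w)) ⊎ Fix i (Bead (act n w)) ⊎ Dsc i (Bead (act n w)) → Up (i ∷ w) (act n (i ∷ w))
    go (inj₁ asc) = step asc up
    go (inj₂ (inj₁ fx)) =
      let j , j≢0 , e = Fix⇒~ up fx
          w~ = ~trans (~sym (~trans (~-++ˡ w (~-square j [])) (~-reflexive (++-identityʳ w))))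
                 (~trans (~-reflexive (sym (++-assoc w (j ∷ []) (j ∷ [])))) (~-++ʳ (j ∷ []) (~sym e)))
          x , x~ , le = gr (j ∷ []) (j≢0 ∷ []) w w~
      in contradiction (≤-trans (red x x~) le) (<-irrefl refl)
    go (inj₂ (inj₂ dsc)) =
      let v , _ , _ , _ , v~ , len = exchange up dsc
          v~iw = ~trans (~sym (~-square i v)) (~-∷ i v~)
      in contradiction (≤-trans (red v v~iw) (≤-trans (n≤1+n _) (≤-reflexive len))) (<-irrefl refl)

  IsWordOf⇒Up : ∀ {w μ} → IsWordOf n w μ → Up w μ
  IsWordOf⇒Up {w} (gr , red , refl) = Reduced×Grassmannian⇒Up w red gr

  Up⇒IsWordOf : ∀ {w μ} → Up w μ → IsWordOf n w μ
  Up⇒IsWordOf up = Up⇒Grassmannian up , Up⇒Reduced up , Up⇒act up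

  Up-resp-~ : ∀ {w w′ μ} → Up w μ → w ~[ n ] w′ → length w ≡ length w′ → Up w′ μ
  Up-resp-~ {w} {w′} up w~ len =
    subst (Up w′) (sym (Up-~ w~ up up′)) up′
    where
    up′ = Reduced×Grassmannian⇒Up w′
      (λ u u~ → subst (_≤ length u) len (Up⇒Reduced up u (~trans u~ (~sym w~))))
      (λ u par v v~ → let x , x~ , le = Up⇒Grassmannian up u par v (~trans v~ (~-++ʳ u (~sym w~)))
                      in x , ~trans x~ w~ , le)

  -- Containment of cores is compatible with the length

  Dsc? : ∀ {μ} i → Core μ → Dsc i (Bead μ) ⊎ ¬ Dsc i (Bead μ)
  Dsc? {μ} i c with Asc-Fix-Dsc {μ} (antitone c) i
  ... | inj₁ asc        = inj₂ λ (k , r , ¬b , b) → ¬b (Asc⇒suc⇒ (closed c) asc k r b)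
  ... | inj₂ (inj₁ fx)  = inj₂ λ (k , r , ¬b , b) → ¬b (proj₂ (fx k r) b)
  ... | inj₂ (inj₂ dsc) = inj₁ dsc

  exchange-step : ∀ {i w μ} → Up w μ → Dsc i (Bead μ) →
    ∃ λ v → ∃ λ κ → Up v κ × Asc i (Bead κ) × addRes n i κ ≡ μ × suc (length v) ≡ length w
  exchange-step {i} {μ = μ} up dsc with v , κ , upᵥ , e , _ , len ← exchange up dsc =
    v , κ , upᵥ , Asc-resp (≈-sym e) (Dsc⇒Asc (Bead μ) dsc)
    , Core-≡ (Up⇒Core (proj₁ up′)) (Up⇒Core up) (proj₂ up′) , len
    where up′ = Up-∷ (Bead μ) upᵥ e dsc

  -- In a row where κ exceeds γ, the corner of μ in that row is removable and survives in κ.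
  ⊆ₚ-lift : ∀ {i κ μ γ} → Antitone γ → κ ⊆ₚ μ → μ ⊆ₚ addRes n i γ →
    (∀ s → row κ s ≡ row μ s → ¬ Removable i μ s) → κ ⊆ₚ γ
  ⊆ₚ-lift {i} {κ} {μ} {γ} aγ κ⊆μ μ⊆ ¬rem s with row κ s ≤? row γ s | row-addRes i γ s
  ... | yes le | _ = le
  ... | no _   | inj₂ (_ , e) = ≤-trans (κ⊆μ s) (≤-trans (μ⊆ s) (≤-reflexive e))
  ... | no ≰   | inj₁ ((r , _) , e) = contradiction (res≡ , drop (row-addRes i γ (suc s))) (¬rem s κ≡μ)
    where
    μ≤ : row μ s ≤ suc (row γ s)
    μ≤ = ≤-trans (μ⊆ s) (≤-reflexive e)
    κ≡μ : row κ s ≡ row μ s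
    κ≡μ = ≤-antisym (κ⊆μ s) (≤-trans μ≤ (≰⇒> ≰))
    μ≡ : row μ s ≡ suc (row γ s)
    μ≡ = ≤-antisym μ≤ (≤-trans (≰⇒> ≰) (κ⊆μ s))
    res≡ : residue n s (row μ s) ≡ next n i
    res≡ = trans (cong (residue n s) μ≡) (trans (residue-suc s (row γ s)) (cong (next n) r))
    drop : ∀ {A} → Grows (A × row γ (suc s) < row γ s) (row γ (suc s)) (row (addRes n i γ) (suc s)) →
      row μ (suc s) < row μ s
    drop g = ≤-trans (s≤s (≤-trans (μ⊆ (suc s)) (bound g))) (≤-reflexive (sym μ≡))
      where
      bound : ∀ {A x} → Grows (A × row γ (suc s) < row γ s) (row γ (suc s)) x → x ≤ row γ s
      bound (inj₁ ((_ , lt) , refl)) = lt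
      bound (inj₂ (_ , refl))        = aγ s

  ⊆ₚ-lift-¬Dsc : ∀ {i μ γ} → Core μ → Core γ → ¬ Dsc i (Bead μ) →
    μ ⊆ₚ addRes n i γ → μ ⊆ₚ γ
  ⊆ₚ-lift-¬Dsc {i} {μ} {γ} cμ cγ ¬dsc μ⊆ = ⊆ₚ-lift {i} {μ} {μ} {γ} (antitone cγ) (⊆ₚ-refl μ) μ⊆
    λ s _ rem → ¬dsc (Removable⇒Dsc {μ} (antitone cμ) {s = s} rem)

  -- If a row of κ already ended in a removable corner of the new core with residue i, its bead at k
  -- + 1 would be swapped to k, and a bead at k prevents that corner from being removable.
  ⊆ₚ-lift-Asc : ∀ {i κ γ} → Core κ → Asc i (Bead κ) → Core γ →
    addRes n i κ ⊆ₚ addRes n i γ → κ ⊆ₚ γ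
  ⊆ₚ-lift-Asc {i} {κ} {γ} c asc cγ μ⊆ =
    ⊆ₚ-lift {i} {κ} {addRes n i κ} {γ} (antitone cγ) (⊆ₚ-addRes i κ) μ⊆ ¬rem
    where
    μ = addRes n i κ
    ¬rem : ∀ s → row κ s ≡ row μ s → ¬ Removable i μ s
    ¬rem s eq (r , drop) with k , e , rk ← res≡next⇒ _ (trans (res-bead μ s) r) =
      drop⇒¬Bead-pred {μ} (antitone (Core-addRes c asc)) s drop e
        (proj₂ (Bead-addRes-Asc c asc k) (s , trans (cong (_⊖ s) eq) (trans e (sym (σ-lower rk)))))

  -- Induction on the word of the larger core with first letter i. If i is a descent of μ, it is
  -- removed on both sides. Otherwise μ is contained in the previous core already and the inequality
  -- is strict.
  Up-mono : ∀ {w γ v μ} → Up w γ → Up v μ → μ ⊆ₚ γ →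
    length v ≤ length w × (length v ≡ length w → μ ≡ γ)
  Up-mono [] upᵥ μ⊆
    with refl ← row-injective (positive (Up⇒Core upᵥ)) [] (λ s → n≤0⇒n≡0 (μ⊆ s))
    with refl ← Up-[] upᵥ refl = ≤-refl , λ _ → refl
  Up-mono (step {i} {w} {γ} asc up) upᵥ μ⊆ with Dsc? i (Up⇒Core upᵥ)
  ... | inj₁ dsc
    with v , κ , upₖ , ascₖ , refl , len ← exchange-step upᵥ dsc
    with le , eq ← Up-mono up upₖ (⊆ₚ-lift-Asc (Up⇒Core upₖ) ascₖ (Up⇒Core up) μ⊆)
    = subst (_≤ suc (length w)) len (s≤s le)
    , λ e → cong (addRes n i) (eq (suc-injective (trans len e)))
  ... | inj₂ ¬dsc
    with le , _ ← Up-mono up upᵥ (⊆ₚ-lift-¬Dsc (Up⇒Core upᵥ) (Up⇒Core up) ¬dsc μ⊆)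
    = ≤-trans le (n≤1+n _) , λ e → contradiction e (<⇒≢ (s≤s le))

  -- Deletion of a letter, and words that need not be reduced

  data Deletes : Word n → Word n → Set where
    here  : ∀ {i w} → Deletes w (i ∷ w)
    there : ∀ {i v w} → Deletes v w → Deletes (i ∷ v) (i ∷ w)

  -- The deleted letter is the first one that is not a descent of what remains of μ. At that point
  -- the equality case of `Up-mono` identifies the remainder of μ with the core of the tail.
  deletion : ∀ {w γ v μ} → Up w γ → Up v μ → μ ⊆ₚ γ → suc (length v) ≡ length w →
    ∃ λ w′ → Deletes w′ w × Up w′ μ
  deletion (step {i} {w} {γ} asc up) upᵥ μ⊆ len with Dsc? i (Up⇒Core upᵥ)
  ... | inj₁ dsc
    with v , κ , upₖ , ascₖ , refl , lenₖ ← exchange-step upᵥ dsc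
    with w′ , del , up′ ← deletion up upₖ
           (⊆ₚ-lift-Asc (Up⇒Core upₖ) ascₖ (Up⇒Core up) μ⊆)
           (trans lenₖ (suc-injective len))
    = i ∷ w′ , there del , step ascₖ up′
  ... | inj₂ ¬dsc
    with refl ← proj₂ (Up-mono up upᵥ (⊆ₚ-lift-¬Dsc (Up⇒Core upᵥ) (Up⇒Core up) ¬dsc μ⊆))
                  (suc-injective len)
    = w , here , up

  Deletes-++ : ∀ u {v w} → Deletes w (u ++ v) →
    (∃ λ u′ → Deletes u′ u × w ≡ u′ ++ v) ⊎ (∃ λ v′ → Deletes v′ v × w ≡ u ++ v′)
  Deletes-++ []      del         = inj₂ (_ , del , refl)
  Deletes-++ (i ∷ u) here        = inj₁ (u , here , refl)
  Deletes-++ (i ∷ u) (there del) with Deletes-++ u del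
  ... | inj₁ (u′ , d , refl) = inj₁ (i ∷ u′ , there d , refl)
  ... | inj₂ (v′ , d , refl) = inj₂ (v′ , d , refl)

  Deletes-All : ∀ {P : Fin n → Set} {v w} → Deletes v w → All P w → All P v
  Deletes-All here      (_ ∷ ps) = ps
  Deletes-All (there d) (p ∷ ps) = p ∷ Deletes-All d ps

  Deletes-AllPairs : ∀ {R : Fin n → Fin n → Set} {v w} → Deletes v w → AllPairs R w → AllPairs R v
  Deletes-AllPairs here      (_ ∷ ps) = ps
  Deletes-AllPairs (there d) (p ∷ ps) = Deletes-All d p ∷ Deletes-AllPairs d ps

  Deletes-act : ∀ {v w} → Deletes v w → act n v ⊆ₚ act n w
  Deletes-act {v} (here {i}) = ⊆ₚ-addRes i (act n v)
  Deletes-act (there {i} {v} {w} d) = addRes-mono i (act n v) (act n w) (Deletes-act d)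

  addRes-Asc : ∀ {μ} i → Core μ → Asc i (Bead μ) ⊎ addRes n i μ ≡ μ
  addRes-Asc {μ} i c with Asc-Fix-Dsc {μ} (antitone c) i
  ... | inj₁ asc = inj₁ asc
  ... | inj₂ fix-or-dsc = inj₂ (row-injective (positive-addResGo i 0 nothing (positive c)) (positive c) same)
    where
    ¬add : ∀ s → ¬ Addable i μ s
    ¬add s add = go fix-or-dsc (Addable⇒Asc {μ} (antitone c) {s = s} add)
      where
      go : Fix i (Bead μ) ⊎ Dsc i (Bead μ) → ¬ Asc i (Bead μ)
      go (inj₁ fx)                (k , r , b , ¬b) = ¬b (proj₁ (fx k r) b)
      go (inj₂ (k , r , ¬b , b))  asc              = ¬b (Asc⇒suc⇒ (closed c) asc k r b)
    same : ∀ s → row (addRes n i μ) s ≡ row μ s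
    same s with row-addRes i μ s
    ... | inj₁ (add , _) = contradiction add (¬add s)
    ... | inj₂ (_ , e)   = e

  act-Up : ∀ u → Up u (act n u) ⊎ ∃ λ v → Up v (act n u) × length v < length u
  act-Up [] = inj₁ []
  act-Up (i ∷ u) with act-Up u
  ... | inj₁ up with addRes-Asc i (Up⇒Core up)
  ... | inj₁ asc = inj₁ (step asc up)
  ... | inj₂ e   = inj₂ (u , subst (Up u) (sym e) up , ≤-refl)
  act-Up (i ∷ u) | inj₂ (v , up , lt) with addRes-Asc i (Up⇒Core up)
  ... | inj₁ asc = inj₂ (i ∷ v , step asc up , s≤s lt)
  ... | inj₂ e   = inj₂ (v , subst (Up v) (sym e) up , ≤-trans lt (n≤1+n _))

  -- Cores in terms of hook lengths

  private
    col-accept : ∀ {c x} xs → c < x → col (x ∷ xs) c ≡ suc (col xs c)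
    col-accept {c} xs c<x = cong length (filter-accept (c <?_) c<x)

    col-reject : ∀ {c x} xs → ¬ c < x → col (x ∷ xs) c ≡ col xs c
    col-reject {c} xs c≮x = cong length (filter-reject (c <?_) c≮x)

    row≤head : ∀ {x xs} → Antitone (x ∷ xs) → ∀ s → row (x ∷ xs) s ≤ x
    row≤head {x} {xs} anti s = antitone-≤ (x ∷ xs) anti {0} {s} z≤n

  <col⇒<row : ∀ μ → Antitone μ → ∀ c s → s < col μ c → c < row μ s
  <col⇒<row (x ∷ xs) anti c s lt with c <? x
  <col⇒<row (x ∷ xs) anti c zero    lt | yes c<x = c<x
  <col⇒<row (x ∷ xs) anti c (suc s) lt | yes c<x =
    <col⇒<row xs (antitone-tail {x} anti) c s (≤-pred (≤-trans lt (≤-reflexive (col-accept xs c<x))))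
  <col⇒<row (x ∷ xs) anti c s lt | no c≮x = contradiction
    (≤-trans (<col⇒<row xs (antitone-tail {x} anti) c s (≤-trans lt (≤-reflexive (col-reject xs c≮x))))
             (row≤head {x} {xs} anti (suc s))) c≮x

  col≤⇒row≤ : ∀ μ → Antitone μ → ∀ c s → col μ c ≤ s → row μ s ≤ c
  col≤⇒row≤ [] anti c s le = z≤n
  col≤⇒row≤ (x ∷ xs) anti c s le with c <? x
  ... | no c≮x = ≤-trans (row≤head {x} {xs} anti s) (≮⇒≥ c≮x)
  col≤⇒row≤ (x ∷ xs) anti c zero le | yes c<x =
    contradiction (≤-trans (≤-reflexive (sym (col-accept xs c<x))) le) λ ()
  col≤⇒row≤ (x ∷ xs) anti c (suc s) le | yes c<x =
    col≤⇒row≤ xs (antitone-tail {x} anti) c s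
      (≤-pred (≤-trans (≤-reflexive (sym (col-accept xs c<x))) le))

  -- A cell of hook length n in row r would make bead μ r - n a gap.
  hook≢n : ∀ {μ} → Core μ → ∀ r c → c < row μ r → hook μ r c ≢ n
  hook≢n {μ} cμ r c c<row hook≡n
    with a , eₐ ← m≤n⇒∃[o]m+o≡n c<row
    with b , e_b ← m≤n⇒∃[o]m+o≡n (≰⇒> λ le → <⇒≱ c<row (col≤⇒row≤ μ (antitone cμ) c r le))
    with s , e ← closed cμ (row μ r ⊖ (r + n)) (r , sym (trans (ℤ.distribˡ-⊖-+-pos n (row μ r) (r + n))
                   (trans (cong₂ _⊖_ (+-comm (row μ r) n) (+-comm r n)) (ℤ.+-cancelˡ-⊖ n (row μ r) r))))
    = go (≤-<-connex (col μ c) s)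
    where
    open +-*-Solver
    n≡ : a + suc b ≡ n
    n≡ = begin
      a + suc b                                        ≡⟨ cong₂ (λ x y → x + y ∸ 1) (m+n∸m≡n c (suc a)) (m+n∸m≡n r (suc b)) ⟨
      ((c + suc a ∸ c) + (r + suc b ∸ r)) ∸ 1          ≡⟨ cong₂ (λ x y → ((x ∸ c) + (y ∸ r)) ∸ 1)
                                                            (trans (+-suc c a) eₐ) (trans (+-suc r b) e_b) ⟩
      hook μ r c                                       ≡⟨ hook≡n ⟩
      n                                                ∎
    eq : row μ s + (r + n) ≡ row μ r + s
    eq = ⊖-cancel (row μ s) s (row μ r) (r + n) e
    sum≡ : row μ r + col μ c ≡ suc (c + (r + n))
    sum≡ = begin
      row μ r + col μ c                ≡⟨ cong₂ _+_ eₐ e_b ⟨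
      suc c + a + (suc r + b)          ≡⟨ solve 4 (λ c a r b → con 1 :+ c :+ a :+ (con 1 :+ r :+ b)
                                            := con 1 :+ (c :+ (r :+ (a :+ (con 1 :+ b))))) refl c a r b ⟩
      suc (c + (r + (a + suc b)))      ≡⟨ cong (λ x → suc (c + (r + x))) n≡ ⟩
      suc (c + (r + n))                ∎
    go : col μ c ≤ s ⊎ s < col μ c → _
    go (inj₁ le) = <⇒≱ {c + (r + n)} {row μ r + s}
      (≤-trans (≤-reflexive (sym sum≡)) (+-monoʳ-≤ (row μ r) le))
      (≤-trans (≤-reflexive (sym eq)) (+-monoˡ-≤ (r + n) (col≤⇒row≤ μ (antitone cμ) c s le)))
    go (inj₂ lt) = <⇒≱ {row μ r + s} {row μ r + col μ c} (+-monoʳ-< (row μ r) lt)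
      (≤-trans (≤-reflexive sum≡) (≤-trans (+-monoˡ-≤ (r + n) (<col⇒<row μ (antitone cμ) c s lt)) (≤-reflexive eq)))

  Core⇒IsCore : ∀ {μ} → Core μ → IsCore n μ
  Core⇒IsCore {μ} c = (antitone⇒Linked {μ} (antitone c) , positive c) , hook≢n c

  -- The bottom row

  ⟦_⟧ : ℕ → Fin n
  ⟦ x ⟧ = residue n 0 x

  ⟦⟧-distinct : ∀ a {t t′} → t < t′ → t′ < n → ⟦ a + t ⟧ ≢ ⟦ a + t′ ⟧
  ⟦⟧-distinct a {t} {t′} t<t′ t′<n e with d , refl ← m≤n⇒∃[o]m+o≡n t<t′ =
    res-near (+ (a + t)) (suc d) (s≤s z≤n) (≤-trans (s≤s (s≤s (m≤n+m d t))) t′<n)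
      (trans (cong (res ∘ +_) (trans (+-assoc a t (suc d)) (cong (_+_ a) (+-suc t d))))
        (trans (res-⊖ _ 0) (trans (sym e) (sym (res-⊖ _ 0)))))

  next-⟦⟧ : ∀ x → next n ⟦ x ⟧ ≡ ⟦ suc x ⟧
  next-⟦⟧ x = sym (residue-suc 0 x)

  ⟦⟧-surjective : ∀ a i → ∃ λ t → t < n × i ≡ ⟦ a + t ⟧
  ⟦⟧-surjective zero i = toℕ i , toℕ<n i , trans (sym (res-toℕ i)) (res-⊖ (toℕ i) 0)
  ⟦⟧-surjective (suc a) i with ⟦⟧-surjective a i
  ... | suc t , t<n , e = t , ≤-trans (n≤1+n _) t<n , trans e (cong ⟦_⟧ (+-suc a t))
  ... | zero  , _   , e = n ∸ 1 , ≤-reflexive 1+[n∸1] , (begin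
    i                        ≡⟨ e ⟩
    ⟦ a + 0 ⟧                ≡⟨ cong ⟦_⟧ (+-identityʳ a) ⟩
    ⟦ a ⟧                    ≡⟨ residue-period 0 a ⟨
    ⟦ a + n ⟧                ≡⟨ cong (λ x → ⟦ a + x ⟧) 1+[n∸1] ⟨
    ⟦ a + suc (n ∸ 1) ⟧      ≡⟨ cong ⟦_⟧ (+-suc a (n ∸ 1)) ⟩
    ⟦ suc (a + (n ∸ 1)) ⟧    ∎)

  -- Only the letter `⟦ x ⟧` can lengthen a bottom row of length x.
  row₀-≤ : ∀ u {v x} → All (_≢ ⟦ x ⟧) u → row (act n v) 0 ≤ x → row (act n (u ++ v)) 0 ≤ x
  row₀-≤ [] _ le = le
  row₀-≤ (i ∷ u) {v} (i≢ ∷ ps) le with row-addRes i (act n (u ++ v)) 0 | m≤n⇒m<n∨m≡n (row₀-≤ u {v} ps le)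
  ... | inj₂ (_ , e)       | _        = ≤-trans (≤-reflexive e) (row₀-≤ u {v} ps le)
  ... | inj₁ (_ , e)       | inj₁ lt  = ≤-trans (≤-reflexive e) lt
  ... | inj₁ ((r , _) , _) | inj₂ eq  = contradiction (trans (sym r) (cong ⟦_⟧ eq)) i≢

  row₀-≡ : ∀ u {v x} → All (_≢ ⟦ x ⟧) u → row (act n v) 0 ≡ x → row (act n (u ++ v)) 0 ≡ x
  row₀-≡ u {v} ps e = ≤-antisym (row₀-≤ u {v} ps (≤-reflexive e))
    (≤-trans (≤-reflexive (sym e)) (act-++-⊇ u v 0))

  -- The bottom row can always be extended, so its growth under a letter depends on its length alone
  -- and not on the rows above.
  row₀-cong : ∀ u {v w} → row (act n v) 0 ≡ row (act n w) 0 →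
    row (act n (u ++ v)) 0 ≡ row (act n (u ++ w)) 0
  row₀-cong []      e = e
  row₀-cong (i ∷ u) {v} {w} e
    with eq ← row₀-cong u {v} {w} e
    with row-addRes i (act n (u ++ v)) 0 | row-addRes i (act n (u ++ w)) 0
  ... | inj₁ (_ , e₁) | inj₁ (_ , e₂) = trans e₁ (trans (cong suc eq) (sym e₂))
  ... | inj₂ (_ , e₁) | inj₂ (_ , e₂) = trans e₁ (trans eq (sym e₂))
  ... | inj₁ ((r , _) , _) | inj₂ (¬add , _) = contradiction (trans (cong ⟦_⟧ (sym eq)) r , tt) ¬add
  ... | inj₂ (¬add , _) | inj₁ ((r , _) , _) = contradiction (trans (cong ⟦_⟧ eq) r , tt) ¬add

  row₀-suc : ∀ i μ → i ≡ ⟦ row μ 0 ⟧ → row (addRes n i μ) 0 ≡ suc (row μ 0)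
  row₀-suc i μ refl with row-addRes i μ 0
  ... | inj₁ (_ , e)    = e
  ... | inj₂ (¬add , _) = contradiction (refl , tt) ¬add

  bead≤bead₀ : ∀ {μ} → Antitone μ → ∀ s → bead μ s ℤ.≤ bead μ 0
  bead≤bead₀ {μ} anti s = ℤ.≤-trans (ℤ.⊖-monoˡ-≤ s (antitone-≤ μ anti {0} {s} z≤n)) (ℤ.⊖-monoʳ-≥-≤ (row μ 0) {s} {0} z≤n)

  -- The bead of the bottom row is the largest one.
  Asc⇒next≢⟦row₀⟧ : ∀ {i μ} → Core μ → Asc i (Bead μ) → next n i ≢ ⟦ row μ 0 ⟧
  Asc⇒next≢⟦row₀⟧ {i} {μ} c (_ , r , (zero , refl) , _) e =
    next≢id i (trans e (trans (sym (res-bead μ 0)) r))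
  Asc⇒next≢⟦row₀⟧ {i} {μ} c (_ , r , (suc s , refl) , ¬suc) e = ¬suc
    (closed-≤ (closed c) le (trans (res-suc≡ r) (trans e (sym (res-bead μ 0)))) (0 , refl))
    where
    le : ℤ.suc (bead μ (suc s)) ℤ.≤ bead μ 0
    le = ℤ.≤-trans (ℤ.≤-reflexive (trans (suc-⊖ (row μ (suc s)) (suc s)) (ℤ.[1+m]⊖[1+n]≡m⊖n (row μ (suc s)) s)))
      (ℤ.≤-trans (ℤ.⊖-monoˡ-≤ s (antitone c s)) (bead≤bead₀ {μ} (antitone c) s))

  -- The core R (n - 1) λ

  run : ℕ → ℕ → Word n
  run a zero    = []
  run a (suc k) = ⟦ a + k ⟧ ∷ run a k

  module _ (a : ℕ) where

    private
      ⟦⟧≢ : ∀ {j t t′} → res j ≡ ⟦ a + t ⟧ → t < t′ → t′ < n → res j ≢ ⟦ a + t′ ⟧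
      ⟦⟧≢ r t<t′ t′<n e = ⟦⟧-distinct a t<t′ t′<n (trans (sym r) e)

      ⟦⟧≢′ : ∀ {j t t′} → res j ≡ ⟦ a + t ⟧ → t′ < t → t < n → res j ≢ ⟦ a + t′ ⟧
      ⟦⟧≢′ r t′<t t<n e = ⟦⟧-distinct a t′<t t<n (trans (sym e) r)

      next≡ : ∀ t → next n ⟦ a + t ⟧ ≡ ⟦ a + suc t ⟧
      next≡ t = trans (next-⟦⟧ (a + t)) (cong ⟦_⟧ (sym (+-suc a t)))

    -- With `perm-run-below` and `perm-run-top`: the run cycles the k + 1 residues `⟦ a ⟧`, ...,
    -- `⟦ a + k ⟧`, raising all by one except the last, which drops by k.
    perm-run-above : ∀ k {j t} → k < t → t < n → res j ≡ ⟦ a + t ⟧ → perm (run a k) j ≡ j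
    perm-run-above zero    _   _   _ = refl
    perm-run-above (suc k) {t = t} k<t t<n r = trans
      (cong (perm (run a k)) (σ-other (⟦⟧≢′ r (≤-trans (n≤1+n _) k<t) t<n)
        (λ e → ⟦⟧≢′ r k<t t<n (trans e (next≡ k)))))
      (perm-run-above k (≤-trans (n≤1+n _) k<t) t<n r)

    perm-run-below : ∀ k {j t} → t < k → k < n → res j ≡ ⟦ a + t ⟧ → perm (run a k) j ≡ ℤ.suc j
    perm-run-below (suc k) {t = t} (s≤s t≤k) k<n r with m≤n⇒m<n∨m≡n t≤k
    ... | inj₁ t<k = trans
      (cong (perm (run a k)) (σ-other (⟦⟧≢ r t<k (≤-trans (n≤1+n _) k<n))
        (λ e → ⟦⟧≢ r (s≤s t≤k) k<n (trans e (next≡ k)))))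
      (perm-run-below k t<k (≤-trans (n≤1+n _) k<n) r)
    ... | inj₂ refl = trans (cong (perm (run a k)) (σ-lower r))
      (perm-run-above k ≤-refl k<n (trans (res-suc≡ r) (next≡ k)))

    +-sucℤ : ∀ j k → j ℤ.+ + (suc k) ≡ ℤ.suc (j ℤ.+ + k)
    +-sucℤ j k = trans (sym (ℤ.+-assoc j (+ 1) (+ k)))
      (trans (cong (ℤ._+ + k) (ℤ.+-comm j (+ 1))) (ℤ.+-assoc (+ 1) j (+ k)))

    res-+ : ∀ {j} k → res j ≡ ⟦ a ⟧ → res (j ℤ.+ + k) ≡ ⟦ a + k ⟧
    res-+ {j} zero    r = trans (cong res (ℤ.+-identityʳ j)) (trans r (cong ⟦_⟧ (sym (+-identityʳ a))))
    res-+ {j} (suc k) r = trans (cong res (+-sucℤ j k)) (trans (res-suc≡ (res-+ k r)) (next≡ k))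

    perm-run-top : ∀ k {j} → res j ≡ ⟦ a ⟧ → perm (run a k) (j ℤ.+ + k) ≡ j
    perm-run-top zero    {j} r = ℤ.+-identityʳ j
    perm-run-top (suc k) {j} r = trans
      (cong (perm (run a k)) (trans (cong (σ ⟦ a + k ⟧) (+-sucℤ j k)) (σ-upper (res-+ k r))))
      (perm-run-top k r)

  Up-perm : ∀ u {w μ} → Up (u ++ w) μ → Bead μ ≈ Bead (act n w) ∘ perm u
  Up-perm [] up rewrite Up⇒act up = λ k → (λ b → b) , (λ b → b)
  Up-perm (i ∷ u) (step asc up) = ≈-trans (Bead-addRes-Asc (Up⇒Core up) asc) (∘-≈ i (Up-perm u up))

  ++-∷ : ∀ (u : Word n) x v → (u ++ x ∷ []) ++ v ≡ u ++ x ∷ v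
  ++-∷ u x v = ++-assoc u (x ∷ []) v

  length-insert : ∀ (u : Word n) x v → length (u ++ x ∷ v) ≡ suc (length (u ++ v))
  length-insert []      x v = refl
  length-insert (_ ∷ u) x v = cong suc (length-insert u x v)

  -- Decreasing words in a window of residues

  -- Missing letters are recorded too, so that a recursion on the derivation meets every residue of
  -- the window once, smallest first.
  data DecreasingBetween : ℕ → ℕ → Word n → Set where
    nil  : ∀ {a} → DecreasingBetween a 0 []
    take : ∀ {a m u} → DecreasingBetween (suc a) m u → DecreasingBetween a (suc m) (u ++ ⟦ a ⟧ ∷ [])
    skip : ∀ {a m u} → DecreasingBetween (suc a) m u → DecreasingBetween a (suc m) u

  Within : ℕ → ℕ → Fin n → Set
  Within a m i = ∃ λ t → t < m × i ≡ ⟦ a + t ⟧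

  Within-suc : ∀ {a m i} → Within (suc a) m i → Within a (suc m) i
  Within-suc {a} (t , t<m , e) = suc t , s≤s t<m , trans e (cong ⟦_⟧ (sym (+-suc a t)))

  Within-tail : ∀ {a m i} → Within a (suc m) i → i ≢ ⟦ a ⟧ → Within (suc a) m i
  Within-tail {a} (zero  , _       , e) i≢ = contradiction (trans e (cong ⟦_⟧ (+-identityʳ a))) i≢
  Within-tail {a} (suc t , s≤s t<m , e) _  = t , t<m , trans e (cong ⟦_⟧ (+-suc a t))

  decreasing-within : ∀ {a m u} → DecreasingBetween a m u → All (Within a m) u
  decreasing-within nil = []
  decreasing-within {a} (take d) = All.++⁺ (All.map Within-suc (decreasing-within d))
    ((0 , s≤s z≤n , cong ⟦_⟧ (sym (+-identityʳ a))) ∷ [])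
  decreasing-within (skip d) = All.map Within-suc (decreasing-within d)

  run-within : ∀ a m → All (Within a m) (run a m)
  run-within a zero    = []
  run-within a (suc m) = (m , ≤-refl , refl)
    ∷ All.map (λ (t , t<m , e) → t , ≤-trans t<m (n≤1+n _) , e) (run-within a m)

  -- The run of n - 1 letters applied to λ

  module _ {wλ λ′} (upλ : Up wλ λ′) where

    private
      ℓ = row λ′ 0
      cλ = Up⇒Core upλ

      row₀-wλ : row (act n wλ) 0 ≡ ℓ
      row₀-wλ = cong (λ μ → row μ 0) (Up⇒act upλ)

    row₀-run : ∀ k → row (act n (run ℓ k ++ wλ)) 0 ≡ ℓ + k
    row₀-run zero    = trans row₀-wλ (sym (+-identityʳ ℓ))
    row₀-run (suc k) = trans
      (row₀-suc ⟦ ℓ + k ⟧ (act n (run ℓ k ++ wλ)) (cong ⟦_⟧ (sym (row₀-run k))))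
      (trans (cong suc (row₀-run k)) (sym (+-suc ℓ k)))

    Up-run : ∀ k → Up (run ℓ k ++ wλ) (act n (run ℓ k ++ wλ))
    Up-run zero    = subst (Up wλ) (sym (Up⇒act upλ)) upλ
    Up-run (suc k) = step (Addable⇒Asc {act n (run ℓ k ++ wλ)} (antitone (Up⇒Core (Up-run k))) {s = 0}
      (cong ⟦_⟧ (row₀-run k) , tt)) (Up-run k)

    private
      positive-R : Positive (R (n ∸ 1) λ′)
      positive-R = ≤-trans (≤-pred (subst (2 ≤_) (sym 1+[n∸1]) 2≤n)) (m≤n+m (n ∸ 1) ℓ) ∷ positive cλ

      antitone-R : Antitone (R (n ∸ 1) λ′)
      antitone-R zero    = m≤m+n ℓ (n ∸ 1)
      antitone-R (suc s) = antitone cλ s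

      bead-suc-R : ∀ s → ℤ.suc (bead (R (n ∸ 1) λ′) (suc s)) ≡ bead λ′ s
      bead-suc-R s = trans (suc-⊖ (row λ′ s) (suc s)) (ℤ.[1+m]⊖[1+n]≡m⊖n (row λ′ s) s)

      +n : ∀ j → ℤ.suc (j ℤ.+ + (n ∸ 1)) ≡ j ℤ.+ + n
      +n j = trans (sym (+-sucℤ 0 j (n ∸ 1))) (cong (λ x → j ℤ.+ + x) 1+[n∸1])

      -- perm (run ℓ (n - 1)) sends k to k + 1, except that it sends k to k - (n - 1) if res k is ⟦ ℓ + (n - 1) ⟧.
      data Case (k : ℤ) : Set where
        shift : perm (run ℓ (n ∸ 1)) k ≡ ℤ.suc k → Case k
        wrap  : ∀ j → k ≡ j ℤ.+ + (n ∸ 1) → res j ≡ ⟦ ℓ ⟧ → perm (run ℓ (n ∸ 1)) k ≡ j → Case k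

      n∸1<n : n ∸ 1 < n
      n∸1<n = ≤-reflexive 1+[n∸1]

      case : ∀ k → Case k
      case k with t , t<n , r ← ⟦⟧-surjective ℓ (res k)
             with m≤n⇒m<n∨m≡n (≤-pred (≤-trans t<n (≤-reflexive (sym 1+[n∸1]))))
      ... | inj₁ t< = shift (perm-run-below ℓ (n ∸ 1) t< n∸1<n r)
      ... | inj₂ refl = wrap j (sym k≡) rj (trans (cong (perm (run ℓ (n ∸ 1))) (sym k≡)) (perm-run-top ℓ (n ∸ 1) rj))
        where
        j = k ℤ.- + (n ∸ 1)
        k≡ : j ℤ.+ + (n ∸ 1) ≡ k
        k≡ = trans (ℤ.+-assoc k _ _) (trans (cong (ℤ._+_ k) (ℤ.+-inverseˡ (+ (n ∸ 1)))) (ℤ.+-identityʳ k))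
        rj : res j ≡ ⟦ ℓ ⟧
        rj = begin
          res j                          ≡⟨ res-period j ⟨
          res (j ℤ.+ + n)                ≡⟨ cong res (+n j) ⟨
          res (ℤ.suc (j ℤ.+ + (n ∸ 1)))  ≡⟨ cong (res ∘ ℤ.suc) k≡ ⟩
          res (ℤ.suc k)                  ≡⟨ res-suc≡ r ⟩
          next n ⟦ ℓ + (n ∸ 1) ⟧         ≡⟨ next-⟦⟧ (ℓ + (n ∸ 1)) ⟩
          ⟦ suc (ℓ + (n ∸ 1)) ⟧          ≡⟨ cong ⟦_⟧ (+-suc ℓ (n ∸ 1)) ⟨
          ⟦ ℓ + suc (n ∸ 1) ⟧            ≡⟨ cong (λ x → ⟦ ℓ + x ⟧) 1+[n∸1] ⟩
          ⟦ ℓ + n ⟧                      ≡⟨ residue-period 0 ℓ ⟩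
          ⟦ ℓ ⟧                          ∎

      Bead-R : Bead (R (n ∸ 1) λ′) ≈ Bead λ′ ∘ perm (run ℓ (n ∸ 1))
      Bead-R k = to (case k) , from (case k)
        where
        to : Case k → Bead (R (n ∸ 1) λ′) k → Bead λ′ (perm (run ℓ (n ∸ 1)) k)
        to _ (zero , refl) = 0 , sym (perm-run-top ℓ (n ∸ 1) {bead λ′ 0} (res-bead λ′ 0))
        to (shift p) (suc s , refl) = s , trans (sym (bead-suc-R s)) (sym p)
        to (wrap j e _ p) (suc s , e′) = subst (Bead λ′) (sym p) (closed cλ j
          (s , trans (sym (bead-suc-R s)) (trans (cong ℤ.suc (trans e′ e)) (+n j))))
        lift : ∀ {k} → Bead λ′ (ℤ.suc k) → Bead (R (n ∸ 1) λ′) k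
        lift (s , e) = suc s , suc-injectiveℤ (trans (bead-suc-R s) e)
        from : Case k → Bead λ′ (perm (run ℓ (n ∸ 1)) k) → Bead (R (n ∸ 1) λ′) k
        from (shift p) b = lift (subst (Bead λ′) p b)
        from (wrap j refl r p) b
          with s , e ← subst (Bead λ′) p b
          -- Here j is a bead of λ on the runner of the largest bead ℓ. If j = ℓ, then k is the bead
          -- of the new bottom row. Otherwise j + n is a bead of λ as well, and moving λ up one row
          -- lowers it to k.
          with d , e₀ ← ≤⇒+ (subst (ℤ._≤ bead λ′ 0) e (bead≤bead₀ {λ′} (antitone cλ) s))
          with res-cancel j d (trans (cong res (sym e₀)) (trans (res-bead λ′ 0) (sym r)))
        ... | divides zero refl = 0 , cong (ℤ._+ + (n ∸ 1)) (trans e₀ (ℤ.+-identityʳ j))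
        ... | divides (suc q) refl = lift (subst (Bead λ′) (sym (+n j))
                (closed-multiple (closed cλ) q (j ℤ.+ + n)
                  (0 , trans e₀ (sym (ℤ.+-assoc j (+ n) (+ (q * n)))))))

    act-run : act n (run ℓ (n ∸ 1) ++ wλ) ≡ R (n ∸ 1) λ′
    act-run = row-injective (positive c) positive-R
      (Bead-injective {act n (run ℓ (n ∸ 1) ++ wλ)} {R (n ∸ 1) λ′} (antitone c) antitone-R
        (≈-trans (Up-perm (run ℓ (n ∸ 1)) (Up-run (n ∸ 1)))
        (≈-trans (λ k → subst (λ μ → Bead μ (perm (run ℓ (n ∸ 1)) k)) (Up⇒act upλ)
                      , subst (λ μ → Bead μ (perm (run ℓ (n ∸ 1)) k)) (sym (Up⇒act upλ)))
                 (≈-sym Bead-R))))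
      where c = Up⇒Core (Up-run (n ∸ 1))

  -- Cyclically decreasing words

  -- A condition on pairs passes to subwords at once, as the deletions require.
  NotBefore : Fin n → Fin n → Set
  NotBefore a b = a ≢ b × b ≢ next n a

  CycDecWord⇒AllPairs : ∀ {u} → CycDecWord n u → AllPairs NotBefore u
  CycDecWord⇒AllPairs {[]} _ = []
  CycDecWord⇒AllPairs {x ∷ u} (x∉u ∷ uniq , prec) =
    All.tabulate (λ b∈u → All.lookup x∉u b∈u , λ { refl → not-next b∈u })
    ∷ CycDecWord⇒AllPairs (uniq , prec-tail)
    where
    not-next : ¬ (next n x ∈ u)
    not-next nx∈u with prec x (here refl) (there nx∈u)
    ... | []    , b , c , e = next≢id x (sym (∷-injectiveˡ e))
    ... | _ ∷ a , b , c , e with refl ← ∷-injectiveʳ e =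
      All.lookup x∉u (∈-++⁺ʳ a (there (∈-++⁺ʳ b (here refl)))) refl
    prec-tail : ∀ i → i ∈ u → next n i ∈ u → Precedes (next n i) i u
    prec-tail i i∈u ni∈u with prec i (there i∈u) (there ni∈u)
    ... | []    , b , c , e = contradiction (∷-injectiveˡ e) (All.lookup x∉u ni∈u)
    ... | _ ∷ a , b , c , e = a , b , c , ∷-injectiveʳ e

  AllPairs⇒CycDecWord : ∀ {u} → AllPairs NotBefore u → CycDecWord n u
  AllPairs⇒CycDecWord {[]} [] = [] , λ _ ()
  AllPairs⇒CycDecWord {x ∷ u} (ps ∷ pairs) with uniq , prec ← AllPairs⇒CycDecWord pairs =
    (All.map proj₁ ps ∷ uniq) , prec′
    where
    prec′ : ∀ i → i ∈ x ∷ u → next n i ∈ x ∷ u → Precedes (next n i) i (x ∷ u)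
    prec′ i (here refl)  (here e)     = contradiction e (next≢id x)
    prec′ i (here refl)  (there ni∈u) = contradiction refl (proj₂ (All.lookup ps ni∈u))
    prec′ i (there i∈u)  (there ni∈u) with a , b , c , e ← prec i i∈u ni∈u = x ∷ a , b , c , cong (x ∷_) e
    prec′ i (there i∈u)  (here refl)  with b , c , e ← ∈-∃++ i∈u = [] , b , c , cong (next n i ∷_) e

  AllPairs-run : ∀ a m → m < n → AllPairs NotBefore (run a m)
  AllPairs-run a zero    _   = []
  AllPairs-run a (suc m) m<n =
    All.map (λ { (t , t<m , refl) →
        (λ e → ⟦⟧-distinct a t<m (≤-trans (n≤1+n _) m<n) (sym e))
      , (λ e → ⟦⟧-distinct a (≤-trans t<m (n≤1+n m)) m<n
                 (trans e (trans (next-⟦⟧ (a + m)) (cong ⟦_⟧ (sym (+-suc a m)))))) })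
      (run-within a m)
    ∷ AllPairs-run a m (≤-trans (n≤1+n _) m<n)

  AllPairs-split : ∀ x {c y} → AllPairs NotBefore (x ++ c ∷ y) → All (_≢ c) x × All (NotBefore c) y
  AllPairs-split []      (ps ∷ _) = [] , ps
  AllPairs-split (i ∷ x) (ps ∷ pairs) with qs , rs ← AllPairs-split x pairs =
    proj₁ (All.head (All.++⁻ʳ x ps)) ∷ qs , rs

  Deletes-middle : ∀ x {c} y → Deletes (x ++ y) (x ++ c ∷ y)
  Deletes-middle []      y = here
  Deletes-middle (_ ∷ x) y = there (Deletes-middle x y)

  ~-move : ∀ {c} {y : Word n} → All (λ b → ¬ Adjacent n c b) y → (c ∷ y) ~[ n ] (y ++ c ∷ [])
  ~-move []                 = ~refl
  ~-move {y = b ∷ y} (p ∷ ps) = ~trans (~-commute p y) (~-∷ b (~-move ps))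

  -- The smallest letter a commutes with every letter to its right: a + 1 cannot follow it in a
  -- cyclically decreasing word, and a - 1 lies outside a window of fewer than n residues. It can
  -- therefore be moved to the end.
  sort : ∀ m a {u} → m < n → AllPairs NotBefore u → All (Within a m) u →
    ∃ λ v → DecreasingBetween a m v × u ~[ n ] v × length u ≡ length v
  sort zero a {[]} _ _ _ = [] , nil , ~refl , refl
  sort zero a {_ ∷ _} _ _ ((_ , () , _) ∷ _)
  sort (suc m) a {u} m<n pairs within with Any.any? (⟦ a ⟧ F.≟_) u
  ... | no a∉u =
    let v , dec , u~v , len = sort m (suc a) (≤-trans (n≤1+n _) m<n) pairs
          (All.tabulate (λ i∈u → Within-tail (All.lookup within i∈u) λ { refl → a∉u i∈u }))
    in v , skip dec , u~v , len
  ... | yes a∈u with x , y , refl ← ∈-∃++ a∈u =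
    let del = Deletes-middle x y
        x≢ , y-ok = AllPairs-split x pairs
        x-in , y-in = All.++⁻ x within
        v , dec , w~v , len = sort m (suc a) (≤-trans (n≤1+n _) m<n) (Deletes-AllPairs del pairs)
          (All.++⁺ (All.zipWith (λ (p , q) → Within-tail q p) (x≢ , x-in))
                   (All.zipWith (λ (p , q) → Within-tail q (proj₁ p ∘ sym)) (y-ok , All.tail y-in)))
        move = ~-move (All.zipWith (λ (p , q) → ¬adj p q) (y-ok , All.tail y-in))
    in v ++ ⟦ a ⟧ ∷ [] , take dec
       , ~trans (~-++ˡ x move) (~trans (~-reflexive (sym (++-assoc x y _))) (~-++ʳ _ w~v))
       , trans (length-insert x ⟦ a ⟧ y)
           (trans (cong suc len) (sym (trans (length-insert v ⟦ a ⟧ []) (cong (suc ∘ length) (++-identityʳ v)))))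
    where
    ¬adj : ∀ {b} → NotBefore ⟦ a ⟧ b → Within a (suc m) b → ¬ Adjacent n ⟦ a ⟧ b
    ¬adj (_ , ≢next) _ (inj₁ e) = ≢next e
    ¬adj _ (t , t<m , refl) (inj₂ e) = ⟦⟧-distinct a {0} {suc t} (s≤s z≤n) (≤-trans (s≤s t<m) m<n)
      (trans (cong ⟦_⟧ (+-identityʳ a)) (trans e (trans (next-⟦⟧ (a + t)) (cong ⟦_⟧ (sym (+-suc a t))))))

  Deg-length : ∀ {w μ} → Up w μ → Deg n μ (length w)
  Deg-length up = _ , Up⇒IsWordOf up , refl

  module _ {wλ λ′} (upλ : Up wλ λ′) where

    private
      ℓ = row λ′ 0
      cλ = Up⇒Core upλ
      D = run ℓ (n ∸ 1)

      n∸1<n : n ∸ 1 < n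
      n∸1<n = ≤-reflexive 1+[n∸1]

      row₀-wλ : row (act n wλ) 0 ≡ ℓ
      row₀-wλ = cong (λ μ → row μ 0) (Up⇒act upλ)

    -- Inserting the letter ⟦ ℓ + k ⟧ yields a core containing ν (monotonicity of act) with a longer
    -- bottom row, hence of larger degree, so the longer word is again reduced.
    insert : ∀ {k m v ν} → DecreasingBetween (suc (ℓ + k)) m v → suc (k + m) < n →
      Up (v ++ run ℓ k ++ wλ) ν →
      ∃ λ γ → Up (v ++ run ℓ (suc k) ++ wλ) γ × Cover n ν γ × row ν 0 < row γ 0
    insert {k} {m} {v} {ν} dec k+m<n up = go (act-Up u′)
      where
      u  = v ++ run ℓ k ++ wλ
      u′ = v ++ run ℓ (suc k) ++ wλ
      γ  = act n u′
      ν⊆γ : ν ⊆ₚ γ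
      ν⊆γ = subst (_⊆ₚ γ) (Up⇒act up)
        (act-mono v (run ℓ k ++ wλ) (run ℓ (suc k) ++ wλ) (⊆ₚ-addRes ⟦ ℓ + k ⟧ (act n (run ℓ k ++ wλ))))
      avoid : All (_≢ ⟦ ℓ + k ⟧) v
      avoid = All.map (λ { (t , t<m , refl) e → ⟦⟧-distinct (ℓ + k) {0} {suc t} (s≤s z≤n)
          (≤-trans (s≤s (≤-trans t<m (m≤n+m m k))) (≤-trans (n≤1+n _) k+m<n))
          (trans (cong ⟦_⟧ (+-identityʳ (ℓ + k))) (trans (sym e) (cong ⟦_⟧ (sym (+-suc (ℓ + k) t))))) })
        (decreasing-within dec)
      row< : row ν 0 < row γ 0
      row< = ≤-trans
        (≤-reflexive (trans (cong suc (trans (cong (λ μ → row μ 0) (sym (Up⇒act up)))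
          (row₀-≡ v {run ℓ k ++ wλ} avoid (row₀-run upλ k)))) (trans (sym (+-suc ℓ k)) (sym (row₀-run upλ (suc k))))))
        (act-++-⊇ v (run ℓ (suc k) ++ wλ) 0)
      go : Up u′ γ ⊎ (∃ λ w → Up w γ × length w < length u′) → _
      go (inj₁ up′) = γ , up′ , (Core⇒IsCore (Up⇒Core up) , Core⇒IsCore (Up⇒Core up′) , ν⊆γ
        , length u , Deg-length up
        , subst (Deg n γ) (length-insert v ⟦ ℓ + k ⟧ (run ℓ k ++ wλ)) (Deg-length up′)) , row<
      go (inj₂ (w , up′ , lt)) =
        let le , eq = Up-mono up′ up ν⊆γ
            len = ≤-antisym le (≤-pred (≤-trans lt (≤-reflexive (length-insert v ⟦ ℓ + k ⟧ (run ℓ k ++ wλ)))))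
        in contradiction (cong (λ μ → row μ 0) (eq len)) (<⇒≢ row<)

    -- The residues below `⟦ ℓ + k ⟧` have been dealt with and form a full run. If the next letter
    -- is present it joins the run at no cost; if it is missing, inserting it gives one cover. The
    -- covers thus count the letters missing from v.
    chain : ∀ {a k m v ν} → DecreasingBetween a m v → a ≡ ℓ + k → k + m ≡ n ∸ 1 →
      Up (v ++ run ℓ k ++ wλ) ν → ∃ λ c → StripChain n ν (R (n ∸ 1) λ′) c × c + length v ≡ m
    chain {k = k} {ν = ν} nil refl e up = 0 , subst (λ τ → StripChain n ν τ 0) eq done , refl
      where
      eq = trans (sym (Up⇒act up))
        (trans (cong (λ k → act n (run ℓ k ++ wλ)) (trans (sym (+-identityʳ k)) e)) (act-run upλ))
    chain {k = k} {suc m} (take {u = v} dec) refl e up =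
      let c , ch , len = chain {k = suc k} dec (sym (+-suc ℓ k)) (trans (sym (+-suc k m)) e)
            (subst (λ w → Up w _) (++-∷ v ⟦ ℓ + k ⟧ (run ℓ k ++ wλ)) up)
      in c , ch , trans (cong (_+_ c) (trans (length-insert v ⟦ ℓ + k ⟧ []) (cong (suc ∘ length) (++-identityʳ v))))
                    (trans (+-suc c (length v)) (cong suc len))
    chain {k = k} {suc m} (skip {u = v} dec) refl e up =
      let k+m≡ = trans (sym (+-suc k m)) e
          γ , upᵧ , cover , row< = insert {k = k} dec (≤-trans (s≤s (≤-reflexive k+m≡)) n∸1<n) up
          c , ch , len = chain {k = suc k} dec (sym (+-suc ℓ k)) k+m≡ upᵧ
      in suc c , step cover row< ch , cong suc len

    -- When the letter preceding ⟦ ℓ ⟧ is reached the bottom row still has length ℓ.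
    avoids : ∀ {u ν} → AllPairs NotBefore u → Up (u ++ wλ) ν → All (_≢ ⟦ ℓ + (n ∸ 1) ⟧) u
    avoids [] _ = []
    avoids {i ∷ u} (ps ∷ pairs) (step {μ = μ} asc up) = i≢ ∷ avoids pairs up
      where
      -- `⟦ ℓ + (n ∸ 1) ⟧` is the residue ℓ - 1, in a form that makes sense also for ℓ = 0.
      next≡ : next n ⟦ ℓ + (n ∸ 1) ⟧ ≡ ⟦ ℓ ⟧
      next≡ = trans (next-⟦⟧ (ℓ + (n ∸ 1))) (trans (cong ⟦_⟧ (trans (sym (+-suc ℓ (n ∸ 1))) (cong (_+_ ℓ) 1+[n∸1])))
        (residue-period 0 ℓ))
      i≢ : i ≢ ⟦ ℓ + (n ∸ 1) ⟧
      i≢ refl = Asc⇒next≢⟦row₀⟧ (Up⇒Core up) asc (trans next≡ (cong ⟦_⟧ (sym row≡)))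
        where
        row≡ : row μ 0 ≡ ℓ
        -- No letter of u applied before i is `⟦ ℓ ⟧`: it would stand to the right of its
        -- predecessor i, against `NotBefore`.
        row≡ = trans (cong (λ κ → row κ 0) (sym (Up⇒act up)))
          (row₀-≡ u {wλ} (All.map (λ p e → proj₂ p (trans e (sym next≡))) ps) row₀-wλ)

    ≢⇒Within : ∀ {i} → i ≢ ⟦ ℓ + (n ∸ 1) ⟧ → Within ℓ (n ∸ 1) i
    ≢⇒Within {i} i≢
      with t , t<n , e ← ⟦⟧-surjective ℓ i
      with m≤n⇒m<n∨m≡n (≤-pred (≤-trans t<n (≤-reflexive (sym 1+[n∸1]))))
    ... | inj₁ t<   = t , t< , e
    ... | inj₂ refl = contradiction e i≢

    cyclic⇒strip : ∀ {u ν} → CycDecWord n u → Up (u ++ wλ) ν → HorizontalStrongStrip n λ′ ν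
    cyclic⇒strip {u} {ν} cyc up
      with pairs ← CycDecWord⇒AllPairs cyc
      with v , dec , u~v , len ← sort (n ∸ 1) ℓ n∸1<n pairs (All.map ≢⇒Within (avoids pairs up))
      with upᵥ ← Up-resp-~ up (~-++ʳ wλ u~v)
                   (trans (length-++ u) (trans (cong (_+ length wλ) len) (sym (length-++ v))))
      with c , ch , count ← chain {k = 0} dec (sym (+-identityʳ ℓ)) refl upᵥ
      = subst₂ _⊆ₚ_ (Up⇒act upλ) (Up⇒act up) (act-++-⊇ u wλ)
      , c , length wλ , length (v ++ wλ) , Deg-length upλ , Deg-length upᵥ
      , trans (cong (_+_ c) (length-++ v)) (trans (sym (+-assoc c _ _)) (cong (_+ length wλ) count))
      , ch
    private
      -- The excluded residue is ℓ - 1, that of the last cell in the bottom row of λ. For ℓ = 0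
      -- there is no such cell and the condition is vacuous.
      Avoids : Word n → Set
      Avoids = All (λ i → ∀ x → ℓ ≡ suc x → i ≢ ⟦ x ⟧)

      D-avoids : Avoids D
      D-avoids = All.map (λ { (t , t< , refl) x e e′ → ⟦⟧-distinct x {0} {suc t} (s≤s z≤n)
          (≤-trans (s≤s t<) n∸1<n)
          (trans (cong ⟦_⟧ (+-identityʳ x)) (trans (sym e′)
            (cong ⟦_⟧ (trans (cong (_+ t) e) (sym (+-suc x t)))))) })
        (run-within ℓ (n ∸ 1))

    -- Each cover deletes a letter of u ++ wλ. Deleting a letter of wλ would leave the bottom row
    -- unchanged or, since no letter of u has the residue of its last cell in λ, keep it shorter than ℓ.
    strip⇒word : ∀ {μ τ m} → StripChain n μ τ m → τ ≡ R (n ∸ 1) λ′ → λ′ ⊆ₚ μ →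
      ∃ λ u → AllPairs NotBefore u × Avoids u × Up (u ++ wλ) μ
    strip⇒word done refl _ = D , AllPairs-run ℓ (n ∸ 1) n∸1<n , D-avoids
      , subst (Up (D ++ wλ)) (act-run upλ) (Up-run upλ (n ∸ 1))
    strip⇒word {μ} (step {γ = γ} (_ , _ , μ⊆γ , d , (w , word , len) , (w′ , word′ , len′)) row< ch) τ≡ λ⊆μ
      -- Chains are recorded from the bottom, so the recursion first climbs to `R (n - 1) λ` and
      -- letters are deleted on the way back.
      with u , pairs , av , up ← strip⇒word ch τ≡ (⊆ₚ-trans λ′ μ γ λ⊆μ μ⊆γ)
      with x , del , upₓ ← deletion up (IsWordOf⇒Up word) μ⊆γ
             (trans (cong suc len) (trans (sym len′) (proj₂ (Up-unique (IsWordOf⇒Up word′) up))))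
      with Deletes-++ u del
    ... | inj₁ (u′ , del′ , refl) = u′ , Deletes-AllPairs del′ pairs , Deletes-All del′ av , upₓ
    ... | inj₂ (v′ , del′ , refl) = go (m≤n⇒m<n∨m≡n row≤)
      where
      row≤ : row (act n v′) 0 ≤ ℓ
      row≤ = ≤-trans (Deletes-act del′ 0) (≤-reflexive row₀-wλ)
      go : row (act n v′) 0 < ℓ ⊎ row (act n v′) 0 ≡ ℓ → _
      go (inj₂ eq) = contradiction
        (subst₂ _≡_ (cong (λ κ → row κ 0) (Up⇒act upₓ)) (cong (λ κ → row κ 0) (Up⇒act up))
          (row₀-cong u {v′} {wλ} (trans eq (sym row₀-wλ))))
        (<⇒≢ row<)
      go (inj₁ lt) with x , ℓ≡ ← m≤n⇒∃[o]m+o≡n lt = contradiction (λ⊆μ 0) (<⇒≱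
        (≤-trans (s≤s (subst (_≤ row (act n v′) 0 + x) (cong (λ κ → row κ 0) (Up⇒act upₓ))
          (row₀-≤ u {v′} (All.map (λ p → p _ (sym ℓ≡)) av) (m≤m+n _ x)))) (≤-reflexive ℓ≡)))

    strip⇒cyclic : ∀ {ν} → HorizontalStrongStrip n λ′ ν → ∃ λ u → CycDecWord n u × Up (u ++ wλ) ν
    strip⇒cyclic (λ⊆ν , _ , _ , _ , _ , _ , _ , ch) with u , pairs , _ , up ← strip⇒word ch refl λ⊆ν =
      u , AllPairs⇒CycDecWord pairs , up

  -- Passing between products and quotients, and the theorem

  ~-divide : ∀ {u v w : Word n} → (u ++ w) ~[ n ] v → u ~[ n ] (v ++ reverse w)
  ~-divide {u} {v} {w} e = ~trans (~-reflexive (sym (++-identityʳ u)))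
    (~trans (~-++ˡ u (~sym (~-inverseʳ w))) (~trans (~-reflexive (sym (++-assoc u w (reverse w)))) (~-++ʳ (reverse w) e)))

  ~-multiply : ∀ {u v w : Word n} → u ~[ n ] (v ++ reverse w) → (u ++ w) ~[ n ] v
  ~-multiply {u} {v} {w} e = ~trans (~-++ʳ w e)
    (~trans (~-reflexive (++-assoc v (reverse w) w)) (~trans (~-++ˡ v (~-inverseˡ w)) (~-reflexive (++-identityʳ v))))

  Reduced⇒Len : ∀ {u w} → u ~[ n ] w → Reduced n u → Len n w (length u)
  Reduced⇒Len u~w red = (_ , u~w , refl) , λ v v~w → red v (~trans v~w (~sym u~w))

  Len-unique : ∀ {w k l} → Len n w k → Len n w l → k ≡ l
  Len-unique ((u , u~ , refl) , minᵤ) ((v , v~ , refl) , minᵥ) = ≤-antisym (minᵤ v v~) (minᵥ u u~)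

mainTheorem6 : (n : ℕ) .{{_ : NonZero n}} → 2 ≤ n →
    (λ' ν : Partition) → IsCore n λ' → IsCore n ν →
    (wλ wν : Word n) → IsWordOf n wλ λ' → IsWordOf n wν ν →
    HorizontalStrongStrip n λ' ν ⇔
    (CycDecElt n (wν ++ reverse wλ) ×
    Σ ℕ λ a → Σ ℕ λ b → Σ ℕ λ c →
    Len n wν a × Len n wλ b × Len n (wν ++ reverse wλ) c × (a ≡ b + c))
mainTheorem6 n 2≤n λ' ν _ _ wλ wν wordλ@(_ , redλ , _) wordν@(_ , redν , _) = mk⇔ to from
  where
  upλ : Up n 2≤n wλ λ'
  upλ = IsWordOf⇒Up n 2≤n wordλ
  upν : Up n 2≤n wν ν
  upν = IsWordOf⇒Up n 2≤n wordν
  to : _ → _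
  to strip =
    let u , cyc , up = strip⇒cyclic n 2≤n upλ strip
        uwλ~wν , len = Up-unique n 2≤n up upν
        redᵤ = Reduced-prefix n 2≤n u (Up⇒Reduced n 2≤n up)
        u~ = ~-divide n 2≤n {u} {wν} {wλ} uwλ~wν
    in (u , u~ , redᵤ , cyc) , length wν , length wλ , length u
       , Reduced⇒Len n 2≤n ~refl redν , Reduced⇒Len n 2≤n ~refl redλ , Reduced⇒Len n 2≤n u~ redᵤ
       , trans (sym len) (trans (length-++ u) (+-comm (length u) (length wλ)))
  from : _ → _
  from ((u , u~ , redᵤ , cyc) , a , b , c , lenν , lenλ , lenᵤ , a≡b+c) =
    -- Additivity of lengths makes `u ++ wλ` as long as the equivalent reduced word `wν`, so it too
    -- is a word of ν in which every letter adds cells.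
    cyclic⇒strip n 2≤n upλ cyc (Up-resp-~ n 2≤n upν (~sym (~-multiply n 2≤n {u} {wν} {wλ} u~)) (begin
      length wν                ≡⟨ Len-unique n 2≤n lenν (Reduced⇒Len n 2≤n ~refl redν) ⟨
      a                        ≡⟨ a≡b+c ⟩
      b + c                    ≡⟨ cong₂ _+_ (Len-unique n 2≤n lenλ (Reduced⇒Len n 2≤n ~refl redλ))
                                            (Len-unique n 2≤n lenᵤ (Reduced⇒Len n 2≤n u~ redᵤ)) ⟩
      length wλ + length u     ≡⟨ +-comm (length wλ) (length u) ⟩
      length u + length wλ     ≡⟨ length-++ u ⟨
      length (u ++ wλ)         ∎))
    where open ≡-Reasoning
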